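{- Let $p>3$ be a prime and $a$ a rational number whose denominator is not divisible by $p$, with $\big(\frac{a(4-27a)}p\big)=-1$. Then $x\equiv\sum_{k=0}^{[p/3]}\binom{3k}k a^k\pmod p$ is the unique solution of the cubic congruence $(27a-4)x^3+3x+1\equiv0\pmod p$.
   Context: $[x]$ denotes the greatest integer not exceeding $x$. For a rational number $r$ whose denominator is prime to $p$, $\big(\frac rp\big)$ is the Legendre symbol of the residue of $r$ modulo $p$, and congruences mod $p$ are taken in the ring of such rationals. -}

module Defs where

open import Data.Nat as ℕ using (ℕ; zero; suc; _/_)
open import Data.Nat.Divisibility using (_∣_; _∣?_)
open import Data.Nat.Combinatorics using (_C_)
open import Data.Integer as ℤ using (ℤ; +_; -[1+_])
open import Data.Rational as ℚ using (ℚ; ↥_; ↧ₙ_; _+_; _*_; _-_)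
open import Data.List using (List; upTo)
open import Data.Bool.ListAction using (any)
open import Relation.Nullary.Decidable using (⌊_⌋; does)
open import Data.Bool using (Bool; true; false; if_then_else_)

ℕ→ℚ : ℕ → ℚ
ℕ→ℚ n = (+ n) ℚ./ 1

ℤ→ℚ : ℤ → ℚ
ℤ→ℚ z = z ℚ./ 1

_^_ : ℚ → ℕ → ℚ
r ^ zero = ℚ.1ℚ
r ^ suc n = r * (r ^ n)

PIntegral : ℕ → ℚ → Set
PIntegral p r = Data.Nat.Divisibility._∣_ p (↧ₙ r) → Data.Empty.⊥
  where import Data.Empty

-- congruence mod p in the ring of p-integral rationals:
-- r ≡ s (mod p) iff p divides the (reduced) numerator of r - s
_≡_[modℚ_] : ℚ → ℚ → ℕ → Set
r ≡ s [modℚ p ] = p ∣ ℤ.∣ ↥ (r - s) ∣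

congℚ? : (p : ℕ) → ℚ → ℚ → Bool
congℚ? p r s = does (p ∣? ℤ.∣ ↥ (r - s) ∣)

-- Legendre symbol (r / p) of the residue of r modulo p (for p-integral r):
-- 0 if r ≡ 0, 1 if r ≡ y² for some integer y (searched over 0 ≤ y < p,
-- which covers all residues), -1 otherwise.
legendre : ℕ → ℚ → ℤ
legendre p r =
  if congℚ? p r ℚ.0ℚ then + 0
  else if any (λ y → congℚ? p r (ℕ→ℚ y * ℕ→ℚ y)) (upTo p) then + 1
  else -[1+ 0 ]

sumTo : ℕ → (ℕ → ℚ) → ℚ
sumTo zero f = f zero
sumTo (suc n) f = sumTo n f + f (suc n)

binomSum : ℕ → ℚ → ℚ
binomSum p a = sumTo (p / 3) (λ k → ℕ→ℚ ((3 ℕ.* k) C k) * (a ^ k))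

cubic : ℚ → ℚ → ℚ
cubic a x = (ℕ→ℚ 27 * a - ℕ→ℚ 4) * (x ^ 3) + ℕ→ℚ 3 * x + ℚ.1ℚ

{-# OPTIONS --safe #-}
-- Let n = [p/3] and A = 4 - 27a. Modulo p, C(3k,k) ≡ (-27)ᵏ C(n+k,2k), so the sum is the value at y = -27a of the
-- Morgan-Voyce polynomial bₙ = Σ C(n+k,2k) yᵏ. If u + u⁻¹ = y + 2, then bₙ (1 + u) = uⁿ⁺¹ + u⁻ⁿ, and cubing gives
-- (1 + u)(A bₙ³ - 3bₙ) = u³ⁿ⁺² + u⁻³ⁿ⁻¹. The discriminant of u is -27 a A; since a A is a nonresidue, and -3 is a
-- residue exactly when p ≡ 1 (mod 3), the Frobenius map sends u to u⁻¹ if p = 3n+1 and to u if p = 3n+2. In both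
-- cases the right-hand side is 1 + u, hence A bₙ³ - 3bₙ = 1. The root is unique because the discriminant 27² a A of
-- the cubic is not a square.
module Submission where

open import Algebra.Bundles using (CommutativeSemiring)
import Algebra.Properties.CommutativeSemiring.Binomial
import Algebra.Properties.CommutativeSemiring.Exp
import Algebra.Properties.Semiring.Exp
import Algebra.Properties.Semiring.Mult
import Algebra.Properties.Semiring.Sum
import Algebra.Solver.Ring.NaturalCoefficients.Default
open import Algebra.Structures.Biased using (isCommutativeSemiringˡ)
open import Data.Bool using (T; true; false)
open import Data.Bool.ListAction using (any)
open import Data.Fin using (Fin; toℕ; fromℕ; inject₁) renaming (zero to fzero; suc to fsuc)
open import Data.Fin.Properties using (toℕ-fromℕ; toℕ-inject₁; toℕ<n)
open import Data.Integer as ℤ using (ℤ; +_; -[1+_]; 0ℤ; 1ℤ)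
open import Data.Integer.Divisibility.Signed as ℤ∣ using (∣⇒∣ᵤ; ∣ᵤ⇒∣)
open import Data.Integer.GCD using (gcd)
import Data.Integer.Properties as ℤ
open import Data.Integer.Tactic.RingSolver using (solve-∀)
open import Data.List using (List; []; _∷_; length; replicate; upTo)
open import Data.List.Membership.Propositional using (lose)
open import Data.List.Membership.Propositional.Properties using (∈-upTo⁺)
open import Data.List.Properties using (length-replicate)
open import Data.List.Relation.Unary.Any.Properties using (any⁺)
open import Data.Nat as ℕ using (ℕ; zero; suc; _<_; _≤_; _!; _∸_; s≤s; z≤n)
open import Data.Nat.Combinatorics using (_C_; nCn≡1; k![n∸k]!∣n!; nCk+nC[k+1]≡[n+1]C[k+1])
open import Data.Nat.Combinatorics.Specification using (nCk≡n!/k![n-k]!; k>n⇒nCk≡0)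
import Data.Nat.Divisibility as ℕ∣
open import Data.Nat.DivMod using (m/n*n≡m; m≡m%n+[m/n]*n; m%n<n)
open import Data.Nat.Primality using (Prime; euclidsLemma; prime⇒nonTrivial; prime⇒irreducible)
import Data.Nat.Properties as ℕ
import Data.Nat.Tactic.RingSolver as ℕSolver
open import Data.Product using (_,_; _×_; proj₁; proj₂; ∃)
open import Data.Rational as ℚ using (ℚ; ↥_; ↧_; 0ℚ; 1ℚ)
import Data.Rational.Properties as ℚ
open import Data.Sum as Sum using (_⊎_; inj₁; inj₂; [_,_]′)
import Data.Vec.Functional as Vector
open import Function using (_∘_)
open import Level using (0ℓ)
open import Relation.Binary.Bundles using (Setoid)
open import Relation.Binary.PropositionalEquality using (_≡_; refl; sym; trans; cong; cong₂; subst; module ≡-Reasoning)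
import Relation.Binary.Reasoning.Setoid as SetoidReasoning
open import Relation.Binary.Structures using (IsEquivalence)
open import Relation.Nullary using (¬_; yes; no)
open import Relation.Nullary.Decidable using (dec-true)
open import Relation.Nullary.Negation using (contradiction)

-- The unit u generates a field with p² elements or a product of two copies of the field with p
-- elements, according to the sign of its discriminant. Both cases are treated at once by pairs x +
-- y u of integers with coordinatewise congruence. As such a ring may have zero divisors, only u and
-- integers prime to p are ever cancelled, and the cubic is read off from one coefficient instead of
-- dividing by 1 + u. Its leading coefficient comes from (1 + u)² = (y + 4) u, where y + 4 = A. The
-- Frobenius map is explicit: with h = u + u⁻¹, Δ = h² - 4 and m = (p-1)/2, the freshman's dream
-- gives (2u - h)ᵖ = Δᵐ (2u - h), so only the sign of Δᵐ matters. The same formula at h = -1, where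
-- u is a primitive cube root of unity, yields (-3)ᵐ and replaces quadratic reciprocity. The
-- hypothesis on the Legendre symbol, a failed search for a square root, becomes (a A)ᵐ ≡ -1 by
-- Euler's criterion, which rests on counting the roots of Xᵐ - 1.

-- Binomial coefficients at a prime and the freshman's dream.

nCk*[k!*[n∸k]!]≡n! : ∀ {n k} → k ≤ n → (n C k) ℕ.* (k ! ℕ.* (n ∸ k) !) ≡ n !
nCk*[k!*[n∸k]!]≡n! {n} {k} k≤n =
  trans (cong (ℕ._* (k ! ℕ.* (n ∸ k) !)) (nCk≡n!/k![n-k]! k≤n)) (m/n*n≡m (k![n∸k]!∣n! k≤n))
  where instance _ = k ℕ.!* (n ∸ k) !≢0

prime∤k! : ∀ {p} → Prime p → ∀ k → k < p → ¬ p ℕ∣.∣ k !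
prime∤k! {p} pr zero    k<p p∣1 = ℕ∣.>⇒∤ (ℕ.nonTrivial⇒n>1 p {{prime⇒nonTrivial pr}}) p∣1
prime∤k! pr (suc k) k<p p∣ with euclidsLemma (suc k) (k !) pr p∣
... | inj₁ p∣1+k = ℕ∣.>⇒∤ k<p p∣1+k
... | inj₂ p∣k!  = prime∤k! pr k (ℕ.<-trans (ℕ.n<1+n k) k<p) p∣k!

-- p divides p! = C(p,k) k! (p-k)!, but neither factorial on the right, whose factors are all
-- smaller than p.
prime∣pCk : ∀ {p k} → Prime p → 0 < k → k < p → p ℕ∣.∣ p C k
prime∣pCk {p@(suc q)} {k} pr 0<k k<p
  with euclidsLemma (p C k) _ pr
         (subst (p ℕ∣.∣_) (sym (nCk*[k!*[n∸k]!]≡n! (ℕ.<⇒≤ k<p))) (ℕ∣.m∣m*n (q !)))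
... | inj₁ p∣pCk = p∣pCk
... | inj₂ p∣k!*[p∸k]! with euclidsLemma (k !) _ pr p∣k!*[p∸k]!
...   | inj₁ p∣k! = contradiction p∣k! (prime∤k! pr k k<p)
...   | inj₂ p∣[p∸k]! = contradiction p∣[p∸k]! (prime∤k! pr (p ∸ k) (ℕ.∸-monoʳ-< 0<k (ℕ.<⇒≤ k<p)))
prime∣pCk {zero} pr _ ()

module FreshmansDream {c ℓ} (S : CommutativeSemiring c ℓ) where
  open CommutativeSemiring S hiding (refl; sym; trans)
  open Algebra.Properties.CommutativeSemiring.Binomial S using (theorem; binomialTerm)
  open Algebra.Properties.Semiring.Exp semiring using (_^_)
  open Algebra.Properties.Semiring.Mult semiring renaming (_×_ to _·_)
  open Algebra.Properties.Semiring.Sum semiring using (sum; sum-init-last; sum-cong-≋; sum-replicate-zero)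
  open import Relation.Binary.Reasoning.Setoid setoid

  private module E = CommutativeSemiring S

  -- Every inner term of the binomial expansion has a coefficient divisible by p, so only the two
  -- end terms survive. The generality of a semiring killed by p covers the quadratic extensions
  -- used below.
  [x+y]^p≈x^p+y^p : ∀ {p} → Prime p → (∀ x → p · x ≈ 0#) → ∀ x y → (x + y) ^ p ≈ x ^ p + y ^ p
  [x+y]^p≈x^p+y^p {p@(suc q)} pr p·x≈0 x y = begin
    (x + y) ^ p
      ≈⟨ theorem p x y ⟩
    term fzero + sum (λ i → term (fsuc i))
      ≈⟨ +-congˡ (sum-init-last (λ i → term (fsuc i))) ⟩
    term fzero + (sum (λ i → term (fsuc (inject₁ i))) + term (fsuc (fromℕ q)))
      ≈⟨ +-cong first (+-cong middle last) ⟩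
    y ^ p + (0# + x ^ p)
      ≈⟨ +-congˡ (+-identityˡ _) ⟩
    y ^ p + x ^ p
      ≈⟨ +-comm _ _ ⟩
    x ^ p + y ^ p
      ∎
    where
    term : Fin (suc p) → Carrier
    term = binomialTerm x y p

    first : term fzero ≈ y ^ p
    first = E.trans (+-identityʳ _) (*-identityˡ _)

    inner : ∀ k → 0 < k → k < p → ∀ z → (p C k) · z ≈ 0#
    inner k 0<k k<p z with p C k | prime∣pCk pr 0<k k<p
    ... | _ | ℕ∣.divides m refl = begin
      (m ℕ.* p) · z  ≈⟨ ×-assocˡ z m p ⟨
      m · (p · z)    ≈⟨ ×-congʳ m (p·x≈0 z) ⟩
      m · 0#         ≈⟨ ×-homo-zero m ⟩
      0#             ∎
      where
      ×-homo-zero : ∀ m → m · 0# ≈ 0#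
      ×-homo-zero zero    = E.refl
      ×-homo-zero (suc m) = E.trans (+-identityˡ _) (×-homo-zero m)

    middle : sum (λ i → term (fsuc (inject₁ i))) ≈ 0#
    middle = E.trans
      (sum-cong-≋ {x = λ i → term (fsuc (inject₁ i))} {y = Vector.replicate q 0#} (λ i → inner (suc (toℕ (inject₁ i))) (s≤s z≤n)
        (s≤s (subst (_< q) (sym (toℕ-inject₁ i)) (toℕ<n i))) _))
      (sum-replicate-zero q)

    last : term (fsuc (fromℕ q)) ≈ x ^ p
    last rewrite toℕ-fromℕ q | nCn≡1 (suc q) | ℕ.n∸n≡0 q =
      E.trans (+-identityʳ _) (*-identityʳ _)

module _ {c ℓ} (S : CommutativeSemiring c ℓ) where
  open CommutativeSemiring S using (_≈_; semiring) renaming (_+_ to _⊕_; _*_ to _⊗_)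
  open Algebra.Properties.Semiring.Exp semiring using () renaming (_^_ to _↑_)
  open Algebra.Solver.Ring.NaturalCoefficients.Default S using (solve; _:=_; _:+_; _:*_; _:^_)

  -- The term 3xy(x + y) is spelled as three summands and kept in terms of xy and x + y, the two
  -- quantities known when it is applied.
  [x+y]³ : ∀ x y → (x ⊕ y) ↑ 3 ≈ (x ↑ 3 ⊕ y ↑ 3) ⊕ ((x ⊗ y) ⊗ (x ⊕ y) ⊕ ((x ⊗ y) ⊗ (x ⊕ y) ⊕ (x ⊗ y) ⊗ (x ⊕ y)))
  [x+y]³ = solve 2 (λ x y → (x :+ y) :^ 3
    := (x :^ 3 :+ y :^ 3) :+ ((x :* y) :* (x :+ y) :+ ((x :* y) :* (x :+ y) :+ (x :* y) :* (x :+ y)))) (CommutativeSemiring.refl S)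

-- Primes modulo 2 and modulo 3.

prime∧d∣p⇒d≡p : ∀ {p d} → Prime p → 1 < d → d ℕ∣.∣ p → d ≡ p
prime∧d∣p⇒d≡p pr 1<d d∣p = [ (λ d≡1 → contradiction (sym d≡1) (ℕ.<⇒≢ 1<d)) , (λ d≡p → d≡p) ]′ (prime⇒irreducible pr d∣p)

2<p⇒p≡1+2[p/2] : ∀ {p} → Prime p → 2 < p → p ≡ suc (2 ℕ.* (p ℕ./ 2))
2<p⇒p≡1+2[p/2] {p} pr 2<p = trans p≡ (trans (cong (ℕ._+ p ℕ./ 2 ℕ.* 2) p%2≡1) (cong suc (ℕ.*-comm (p ℕ./ 2) 2)))
  where
  p≡ : p ≡ p ℕ.% 2 ℕ.+ p ℕ./ 2 ℕ.* 2
  p≡ = m≡m%n+[m/n]*n p 2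
  p%2≡1 : p ℕ.% 2 ≡ 1
  p%2≡1 with p ℕ.% 2 | m%n<n p 2 | p≡
  ... | 0 | _ | p≡0+ = contradiction (prime∧d∣p⇒d≡p pr (s≤s (s≤s z≤n)) (ℕ∣.divides (p ℕ./ 2) p≡0+)) (ℕ.<⇒≢ 2<p)
  ... | 1 | _ | _ = refl
  ... | suc (suc _) | s≤s (s≤s ()) | _

3<p⇒p≡±1 : ∀ {p} → Prime p → 3 < p → p ≡ 1 ℕ.+ 3 ℕ.* (p ℕ./ 3) ⊎ p ≡ 2 ℕ.+ 3 ℕ.* (p ℕ./ 3)
3<p⇒p≡±1 {p} pr 3<p = Sum.map reorder reorder (split (p ℕ.% 3) (m%n<n p 3) p≡)
  where
  p≡ : p ≡ p ℕ.% 3 ℕ.+ p ℕ./ 3 ℕ.* 3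
  p≡ = m≡m%n+[m/n]*n p 3
  reorder : ∀ {r} → p ≡ r ℕ.+ p ℕ./ 3 ℕ.* 3 → p ≡ r ℕ.+ 3 ℕ.* (p ℕ./ 3)
  reorder {r} eq = trans eq (cong (r ℕ.+_) (ℕ.*-comm (p ℕ./ 3) 3))
  split : ∀ r → r < 3 → p ≡ r ℕ.+ p ℕ./ 3 ℕ.* 3 → p ≡ 1 ℕ.+ p ℕ./ 3 ℕ.* 3 ⊎ p ≡ 2 ℕ.+ p ℕ./ 3 ℕ.* 3
  split 0 _ eq = contradiction (prime∧d∣p⇒d≡p pr (s≤s (s≤s z≤n)) (ℕ∣.divides (p ℕ./ 3) eq)) (ℕ.<⇒≢ 3<p)
  split 1 _ eq = inj₁ eq
  split 2 _ eq = inj₂ eq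
  split (suc (suc (suc _))) (s≤s (s≤s (s≤s ()))) _

module CubicCongruence where
  open import Defs hiding (_^_)
  import Defs
  open import Data.Integer using (_+_; _*_; _-_; -_; _^_)
  open import Data.Integer.Divisibility.Signed using (_∣_; divides; _∣?_)

  -- Powers and finite sums of integers.

  ^-distrib-* : ∀ x y n → (x * y) ^ n ≡ x ^ n * y ^ n
  ^-distrib-* x y zero    = refl
  ^-distrib-* x y (suc n) = trans (cong (x * y *_) (^-distrib-* x y n)) (eq x y (x ^ n) (y ^ n))
    where
    eq : ∀ x y z w → x * y * (z * w) ≡ x * z * (y * w)
    eq = solve-∀

  ∑≤ : ℕ → (ℕ → ℤ) → ℤ
  ∑≤ zero    f = f zero
  ∑≤ (suc n) f = ∑≤ n f + f (suc n)

  ∑≤-cong : ∀ n {f g} → (∀ k → f k ≡ g k) → ∑≤ n f ≡ ∑≤ n g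
  ∑≤-cong zero    f≡g = f≡g zero
  ∑≤-cong (suc n) f≡g = cong₂ _+_ (∑≤-cong n f≡g) (f≡g (suc n))

  ∑≤-+ : ∀ n f g → ∑≤ n (λ k → f k + g k) ≡ ∑≤ n f + ∑≤ n g
  ∑≤-+ zero    f g = refl
  ∑≤-+ (suc n) f g = trans (cong (_+ (f (suc n) + g (suc n))) (∑≤-+ n f g))
                           (eq (∑≤ n f) (∑≤ n g) (f (suc n)) (g (suc n)))
    where
    eq : ∀ x y z w → x + y + (z + w) ≡ x + z + (y + w)
    eq = solve-∀

  ∑≤-* : ∀ n x f → ∑≤ n (λ k → x * f k) ≡ x * ∑≤ n f
  ∑≤-* zero    x f = refl
  ∑≤-* (suc n) x f = trans (cong (_+ x * f (suc n)) (∑≤-* n x f)) (sym (ℤ.*-distribˡ-+ x _ _))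

  ∑≤-shift : ∀ n f → ∑≤ (suc n) f ≡ f 0 + ∑≤ n (f ∘ suc)
  ∑≤-shift zero    f = refl
  ∑≤-shift (suc n) f = trans (cong (_+ f (suc (suc n))) (∑≤-shift n f)) (ℤ.+-assoc (f 0) _ _)

  ∑≤-first : ∀ n f → (∀ k → f (suc k) ≡ 0ℤ) → ∑≤ n f ≡ f 0
  ∑≤-first zero    f f≡0 = refl
  ∑≤-first (suc n) f f≡0 = trans (cong₂ _+_ (∑≤-first n f f≡0) (f≡0 n)) (ℤ.+-identityʳ (f 0))

  -- Morgan-Voyce polynomials and their coefficients.

  -- The Morgan-Voyce polynomials bₙ and Bₙ: for y = u + u⁻¹ - 2, Bₙ = (uⁿ⁺¹ - u⁻ⁿ⁻¹)/(u - u⁻¹) and bₙ = Bₙ - Bₙ₋₁.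
  b B : ℤ → ℕ → ℤ
  b y zero    = 1ℤ
  b y (suc n) = b y n + y * B y n
  B y zero    = 1ℤ
  B y (suc n) = b y (suc n) + B y n

  private
    -- The coefficients of yᵏ in bₙ and in Bₙ.
    β γ : ℕ → ℕ → ℕ
    β n k = (n ℕ.+ k) C (2 ℕ.* k)
    γ n k = suc (n ℕ.+ k) C suc (2 ℕ.* k)

    β-pascal : ∀ n k → β (suc n) (suc k) ≡ γ n k ℕ.+ β n (suc k)
    β-pascal n k = begin
      suc (n ℕ.+ suc k) C (2 ℕ.* suc k)          ≡⟨ cong₂ _C_ (cong suc (ℕ.+-suc n k)) (ℕ.*-suc 2 k) ⟩
      suc (suc (n ℕ.+ k)) C (2 ℕ.+ 2 ℕ.* k)      ≡⟨ nCk+nC[k+1]≡[n+1]C[k+1] (suc (n ℕ.+ k)) (suc (2 ℕ.* k)) ⟨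
      γ n k ℕ.+ suc (n ℕ.+ k) C (2 ℕ.+ 2 ℕ.* k)  ≡⟨ cong (γ n k ℕ.+_) (cong₂ _C_ (ℕ.+-suc n k) (ℕ.*-suc 2 k)) ⟨
      γ n k ℕ.+ β n (suc k)                      ∎
      where open ≡-Reasoning

    γ-pascal : ∀ n k → γ (suc n) k ≡ β (suc n) k ℕ.+ γ n k
    γ-pascal n k = sym (nCk+nC[k+1]≡[n+1]C[k+1] (suc (n ℕ.+ k)) (2 ℕ.* k))

    β₀ : ∀ k → β 0 (suc k) ≡ 0
    β₀ k = k>n⇒nCk≡0 (ℕ.m<m+n (suc k) (s≤s z≤n))

    γ₀ : ∀ k → γ 0 (suc k) ≡ 0
    γ₀ k = k>n⇒nCk≡0 (s≤s (ℕ.m<m+n (suc k) (s≤s z≤n)))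

  -- Pascal's rule for `β` and `γ` is the pair of recurrences defining `b` and `B`, whence the
  -- mutual induction. The limit N is left free because splitting off the term k = 0 shortens the
  -- sum for `B` but not the one for `b`; terms beyond n vanish.
  ∑β≡b : ∀ y n N → n ≤ N → ∑≤ N (λ k → + ((n ℕ.+ k) C (2 ℕ.* k)) * y ^ k) ≡ b y n
  ∑γ≡B : ∀ y n N → n ≤ N → ∑≤ N (λ k → + (suc (n ℕ.+ k) C suc (2 ℕ.* k)) * y ^ k) ≡ B y n

  ∑β≡b y zero    N n≤N = ∑≤-first N _ (λ k → cong (λ c → + c * y ^ suc k) (β₀ k))
  ∑β≡b y (suc n) (suc N) (s≤s n≤N) = begin
    ∑≤ (suc N) (λ k → + β (suc n) k * y ^ k)
      ≡⟨ ∑≤-shift N _ ⟩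
    1ℤ + ∑≤ N (λ k → + β (suc n) (suc k) * y ^ suc k)
      ≡⟨ cong (λ s → 1ℤ + s) (∑≤-cong N λ k → trans (cong (λ c → + c * y ^ suc k) (β-pascal n k))
                                             (eq y (+ γ n k) (+ β n (suc k)) (y ^ k))) ⟩
    1ℤ + ∑≤ N (λ k → + β n (suc k) * y ^ suc k + y * (+ γ n k * y ^ k))
      ≡⟨ cong (λ s → 1ℤ + s) (∑≤-+ N _ _) ⟩
    1ℤ + (∑≤ N (λ k → + β n (suc k) * y ^ suc k) + ∑≤ N (λ k → y * (+ γ n k * y ^ k)))
      ≡⟨ ℤ.+-assoc 1ℤ (∑≤ N (λ k → + β n (suc k) * y ^ suc k)) (∑≤ N (λ k → y * (+ γ n k * y ^ k))) ⟨
    1ℤ + ∑≤ N (λ k → + β n (suc k) * y ^ suc k) + ∑≤ N (λ k → y * (+ γ n k * y ^ k))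
      ≡⟨ cong₂ _+_ (sym (∑≤-shift N (λ k → + β n k * y ^ k))) (∑≤-* N y _) ⟩
    ∑≤ (suc N) (λ k → + β n k * y ^ k) + y * ∑≤ N (λ k → + γ n k * y ^ k)
      ≡⟨ cong₂ (λ s t → s + y * t) (∑β≡b y n (suc N) (ℕ.m≤n⇒m≤1+n n≤N)) (∑γ≡B y n N n≤N) ⟩
    b y n + y * B y n
      ∎
    where
    open ≡-Reasoning
    eq : ∀ y s t z → (s + t) * (y * z) ≡ t * (y * z) + y * (s * z)
    eq = solve-∀

  ∑γ≡B y zero    N n≤N = ∑≤-first N _ (λ k → cong (λ c → + c * y ^ suc k) (γ₀ k))
  ∑γ≡B y (suc n) N 1+n≤N = begin
    ∑≤ N (λ k → + γ (suc n) k * y ^ k)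
      ≡⟨ ∑≤-cong N (λ k → trans (cong (λ c → + c * y ^ k) (γ-pascal n k))
                                (ℤ.*-distribʳ-+ (y ^ k) (+ β (suc n) k) (+ γ n k))) ⟩
    ∑≤ N (λ k → + β (suc n) k * y ^ k + + γ n k * y ^ k)
      ≡⟨ ∑≤-+ N _ _ ⟩
    ∑≤ N (λ k → + β (suc n) k * y ^ k) + ∑≤ N (λ k → + γ n k * y ^ k)
      ≡⟨ cong₂ _+_ (∑β≡b y (suc n) N 1+n≤N) (∑γ≡B y n N (ℕ.<⇒≤ 1+n≤N)) ⟩
    b y (suc n) + B y n
      ∎
    where open ≡-Reasoning

  -- Factorial quotients behind C(3k,k) and C(n+k,2k).

  private
    -- `F k` is (3k)!/k! and, for k ≤ n, `G n k` is (n+k)!/(n-k)!. These are (2k)! times the two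
    -- binomial coefficients, written as products of k factors so that they can be compared modulo p
    -- factor by factor.
    F : ℕ → ℕ
    F zero    = 1
    F (suc k) = F k ℕ.* (3 ℕ.* (1 ℕ.+ 3 ℕ.* k) ℕ.* (2 ℕ.+ 3 ℕ.* k))

    G : ℕ → ℕ → ℕ
    G n zero    = 1
    G n (suc k) = G n k ℕ.* (suc (n ℕ.+ k) ℕ.* (n ∸ k))

    F*k!≡[3k]! : ∀ k → F k ℕ.* k ! ≡ (3 ℕ.* k) !
    F*k!≡[3k]! zero    = refl
    F*k!≡[3k]! (suc k) = begin
      F (suc k) ℕ.* (suc k) !                       ≡⟨ eq k (F k) (k !) ⟩
      (3 ℕ.+ t) ℕ.* ((2 ℕ.+ t) ℕ.* ((1 ℕ.+ t) ℕ.* (F k ℕ.* k !)))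
        ≡⟨ cong (λ x → (3 ℕ.+ t) ℕ.* ((2 ℕ.+ t) ℕ.* ((1 ℕ.+ t) ℕ.* x))) (F*k!≡[3k]! k) ⟩
      (3 ℕ.+ t) !                                   ≡⟨ cong _! (ℕ.*-suc 3 k) ⟨
      (3 ℕ.* suc k) !                               ∎
      where
      open ≡-Reasoning
      t = 3 ℕ.* k
      eq : ∀ k f g → f ℕ.* (3 ℕ.* (1 ℕ.+ 3 ℕ.* k) ℕ.* (2 ℕ.+ 3 ℕ.* k)) ℕ.* ((1 ℕ.+ k) ℕ.* g)
         ≡ (3 ℕ.+ 3 ℕ.* k) ℕ.* ((2 ℕ.+ 3 ℕ.* k) ℕ.* ((1 ℕ.+ 3 ℕ.* k) ℕ.* (f ℕ.* g)))
      eq = ℕSolver.solve-∀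

    G*[n∸k]!≡[n+k]! : ∀ n k → k ≤ n → G n k ℕ.* (n ∸ k) ! ≡ (n ℕ.+ k) !
    G*[n∸k]!≡[n+k]! n zero    k≤n = trans (ℕ.+-identityʳ (n !)) (cong _! (sym (ℕ.+-identityʳ n)))
    G*[n∸k]!≡[n+k]! n (suc k) k<n = begin
      G n k ℕ.* (suc (n ℕ.+ k) ℕ.* (n ∸ k)) ℕ.* r !       ≡⟨ eq (G n k) (suc (n ℕ.+ k)) (n ∸ k) (r !) ⟩
      suc (n ℕ.+ k) ℕ.* (G n k ℕ.* ((n ∸ k) ℕ.* r !))     ≡⟨ cong (λ x → suc (n ℕ.+ k) ℕ.* (G n k ℕ.* (x ℕ.* r !))) (sym 1+r≡n∸k) ⟩
      suc (n ℕ.+ k) ℕ.* (G n k ℕ.* (suc r) !)             ≡⟨ cong (λ x → suc (n ℕ.+ k) ℕ.* (G n k ℕ.* x !)) 1+r≡n∸k ⟩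
      suc (n ℕ.+ k) ℕ.* (G n k ℕ.* (n ∸ k) !)             ≡⟨ cong (suc (n ℕ.+ k) ℕ.*_) (G*[n∸k]!≡[n+k]! n k (ℕ.<⇒≤ k<n)) ⟩
      (suc (n ℕ.+ k)) !                                   ≡⟨ cong _! (ℕ.+-suc n k) ⟨
      (n ℕ.+ suc k) !                                     ∎
      where
      open ≡-Reasoning
      r = n ∸ suc k
      1+r≡n∸k : suc r ≡ n ∸ k
      1+r≡n∸k = sym (ℕ.+-∸-assoc 1 k<n)
      eq : ∀ g s d f → g ℕ.* (s ℕ.* d) ℕ.* f ≡ s ℕ.* (g ℕ.* (d ℕ.* f))
      eq = ℕSolver.solve-∀

    [3k]Ck*[2k]! : ∀ k → ((3 ℕ.* k) C k) ℕ.* (2 ℕ.* k) ! ≡ F k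
    [3k]Ck*[2k]! k = ℕ.*-cancelʳ-≡ _ _ (k !) {{k ℕ.!≢0}} (begin
      c ℕ.* (2 ℕ.* k) ! ℕ.* k !               ≡⟨ eq c ((2 ℕ.* k) !) (k !) ⟩
      c ℕ.* (k ! ℕ.* (2 ℕ.* k) !)             ≡⟨ cong (λ x → c ℕ.* (k ! ℕ.* x !)) (ℕ.m+n∸m≡n k (2 ℕ.* k)) ⟨
      c ℕ.* (k ! ℕ.* (3 ℕ.* k ∸ k) !)         ≡⟨ nCk*[k!*[n∸k]!]≡n! (ℕ.m≤m+n k (2 ℕ.* k)) ⟩
      (3 ℕ.* k) !                             ≡⟨ F*k!≡[3k]! k ⟨
      F k ℕ.* k !                             ∎)
      where
      open ≡-Reasoning
      c = (3 ℕ.* k) C k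
      eq : ∀ c x y → c ℕ.* x ℕ.* y ≡ c ℕ.* (y ℕ.* x)
      eq = ℕSolver.solve-∀

    β*[2k]! : ∀ n k → k ≤ n → β n k ℕ.* (2 ℕ.* k) ! ≡ G n k
    β*[2k]! n k k≤n = ℕ.*-cancelʳ-≡ _ _ ((n ∸ k) !) {{(n ∸ k) ℕ.!≢0}} (begin
      β n k ℕ.* (2 ℕ.* k) ! ℕ.* (n ∸ k) !             ≡⟨ ℕ.*-assoc (β n k) _ _ ⟩
      β n k ℕ.* ((2 ℕ.* k) ! ℕ.* (n ∸ k) !)           ≡⟨ cong (λ x → β n k ℕ.* ((2 ℕ.* k) ! ℕ.* x !)) n∸k≡ ⟩
      β n k ℕ.* ((2 ℕ.* k) ! ℕ.* (n ℕ.+ k ∸ 2 ℕ.* k) !) ≡⟨ nCk*[k!*[n∸k]!]≡n! 2k≤n+k ⟩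
      (n ℕ.+ k) !                                     ≡⟨ G*[n∸k]!≡[n+k]! n k k≤n ⟨
      G n k ℕ.* (n ∸ k) !                             ∎)
      where
      open ≡-Reasoning
      k+k≡2k : k ℕ.+ k ≡ 2 ℕ.* k
      k+k≡2k = cong (k ℕ.+_) (sym (ℕ.+-identityʳ k))
      2k≤n+k : 2 ℕ.* k ≤ n ℕ.+ k
      2k≤n+k = subst (_≤ n ℕ.+ k) k+k≡2k (ℕ.+-monoˡ-≤ k k≤n)
      n∸k≡ : n ∸ k ≡ n ℕ.+ k ∸ 2 ℕ.* k
      n∸k≡ = trans (sym (ℕ.[m+n]∸[m+o]≡n∸o k n k)) (cong₂ _∸_ (ℕ.+-comm k n) k+k≡2k)

  -- Monic polynomials and division by a linear factor.

  -- Coefficients run upward from the constant term and the leading 1 is implicit, so the degree is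
  -- the length of the list and cannot drop modulo p.
  monic : List ℤ → ℤ → ℤ
  monic []       x = 1ℤ
  monic (c ∷ cs) x = c + x * monic cs x

  -- Synthetic division by x - r: the coefficients of the quotient are Horner's partial values at r.
  -- The list argument is the dividend without its constant term.
  quotient : ℤ → List ℤ → List ℤ
  quotient r []       = []
  quotient r (c ∷ cs) = monic (c ∷ cs) r ∷ quotient r cs

  quotient-length : ∀ r cs → length (quotient r cs) ≡ length cs
  quotient-length r []       = refl
  quotient-length r (c ∷ cs) = cong suc (quotient-length r cs)

  monic-difference : ∀ r c cs x → monic (c ∷ cs) x - monic (c ∷ cs) r ≡ (x - r) * monic (quotient r cs) x
  monic-difference r c []        x = eq c x r
    where
    eq : ∀ c x r → (c + x * 1ℤ) - (c + r * 1ℤ) ≡ (x - r) * 1ℤ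
    eq = solve-∀
  monic-difference r c (d ∷ cs) x = begin
    (c + x * s) - (c + r * t)              ≡⟨ eq₁ c x r s t ⟩
    (x - r) * t + x * (s - t)              ≡⟨ cong (λ z → (x - r) * t + x * z) (monic-difference r d cs x) ⟩
    (x - r) * t + x * ((x - r) * q)        ≡⟨ eq₂ x r t q ⟩
    (x - r) * (t + x * q)                  ∎
    where
    open ≡-Reasoning
    s = monic (d ∷ cs) x
    t = monic (d ∷ cs) r
    q = monic (quotient r cs) x
    eq₁ : ∀ c x r s t → (c + x * s) - (c + r * t) ≡ (x - r) * t + x * (s - t)
    eq₁ = solve-∀
    eq₂ : ∀ x r t q → (x - r) * t + x * ((x - r) * q) ≡ (x - r) * (t + x * q)
    eq₂ = solve-∀

  monic-0s : ∀ n x → monic (replicate n 0ℤ) x ≡ x ^ n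
  monic-0s zero    x = refl
  monic-0s (suc n) x = trans (ℤ.+-identityˡ _) (cong (x *_) (monic-0s n x))

  -- Congruences modulo p and the quadratic extension.

  module Modular (p : ℕ) where

    infix 4 _≈_

    record _≈_ (x y : ℤ) : Set where
      constructor mod
      field p∣x-y : + p ∣ x - y
    open _≈_ public

    ≡⇒≈ : ∀ {x y} → x ≡ y → x ≈ y
    ≡⇒≈ {x} refl = mod (divides 0ℤ (ℤ.+-inverseʳ x))

    ≈-refl : ∀ {x} → x ≈ x
    ≈-refl = ≡⇒≈ refl

    ≈-sym : ∀ {x y} → x ≈ y → y ≈ x
    ≈-sym {x} {y} (mod d) = mod (subst (+ p ∣_) (eq x y) (ℤ∣.∣m⇒∣-m d))
      where
      eq : ∀ x y → - (x - y) ≡ y - x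
      eq = solve-∀

    ≈-trans : ∀ {x y z} → x ≈ y → y ≈ z → x ≈ z
    ≈-trans {x} {y} {z} (mod d) (mod e) = mod (subst (+ p ∣_) (eq x y z) (ℤ∣.∣m∣n⇒∣m+n d e))
      where
      eq : ∀ x y z → (x - y) + (y - z) ≡ x - z
      eq = solve-∀

    +-cong : ∀ {x y z w} → x ≈ y → z ≈ w → x + z ≈ y + w
    +-cong {x} {y} {z} {w} (mod d) (mod e) = mod (subst (+ p ∣_) (eq x y z w) (ℤ∣.∣m∣n⇒∣m+n d e))
      where
      eq : ∀ x y z w → (x - y) + (z - w) ≡ (x + z) - (y + w)
      eq = solve-∀

    *-cong : ∀ {x y z w} → x ≈ y → z ≈ w → x * z ≈ y * w
    *-cong {x} {y} {z} {w} (mod d) (mod e) =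
      mod (subst (+ p ∣_) (eq x y z w) (ℤ∣.∣m∣n⇒∣m+n (ℤ∣.∣m⇒∣m*n z d) (ℤ∣.∣n⇒∣m*n y e)))
      where
      eq : ∀ x y z w → (x - y) * z + y * (z - w) ≡ x * z - y * w
      eq = solve-∀

    +-congˡ : ∀ x {y z} → y ≈ z → x + y ≈ x + z
    +-congˡ x = +-cong (≈-refl {x})

    +-congʳ : ∀ x {y z} → y ≈ z → y + x ≈ z + x
    +-congʳ x y≈z = +-cong y≈z (≈-refl {x})

    *-congˡ : ∀ x {y z} → y ≈ z → x * y ≈ x * z
    *-congˡ x = *-cong (≈-refl {x})

    *-congʳ : ∀ x {y z} → y ≈ z → y * x ≈ z * x
    *-congʳ x y≈z = *-cong y≈z (≈-refl {x})

    -‿cong : ∀ {x y} → x ≈ y → - x ≈ - y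
    -‿cong {x} {y} (mod d) = mod (subst (+ p ∣_) (eq x y) (ℤ∣.∣m⇒∣-m d))
      where
      eq : ∀ x y → - (x - y) ≡ - x - - y
      eq = solve-∀

    ^-cong : ∀ {x y} n → x ≈ y → x ^ n ≈ y ^ n
    ^-cong zero    x≈y = ≈-refl
    ^-cong (suc n) x≈y = *-cong x≈y (^-cong n x≈y)

    ≈-setoid : Setoid 0ℓ 0ℓ
    ≈-setoid = record
      { _≈_           = _≈_
      ; isEquivalence = record { refl = ≈-refl ; sym = ≈-sym ; trans = ≈-trans }
      }

    ∣⇒≈0 : ∀ {x} → + p ∣ x → x ≈ 0ℤ
    ∣⇒≈0 {x} d = mod (subst (+ p ∣_) (sym (ℤ.+-identityʳ x)) d)

    ≈0⇒∣ : ∀ {x} → x ≈ 0ℤ → + p ∣ x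
    ≈0⇒∣ {x} (mod d) = subst (+ p ∣_) (ℤ.+-identityʳ x) d

    -- The quadratic extension ℤ[u]/(u² - h u + 1) modulo p, where (x , y) stands for x + y u;
    -- the discriminant of u is h² - 4 and its inverse is h - u.
    module Quadratic (h : ℤ) where

      infix 4 _≋_
      infixl 6 _⊕_
      infixl 7 _⊗_

      record _≋_ (s t : ℤ × ℤ) : Set where
        constructor _&_
        field
          ≋₁ : proj₁ s ≈ proj₁ t
          ≋₂ : proj₂ s ≈ proj₂ t
      open _≋_ public

      ≡⇒≋ : ∀ {s t} → proj₁ s ≡ proj₁ t → proj₂ s ≡ proj₂ t → s ≋ t
      ≡⇒≋ e f = ≡⇒≈ e & ≡⇒≈ f

      _⊕_ _⊗_ : ℤ × ℤ → ℤ × ℤ → ℤ × ℤ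
      (x , y) ⊕ (z , w) = x + z , y + w
      (x , y) ⊗ (z , w) = x * z - y * w , x * w + y * z + h * (y * w)

      ι : ℤ → ℤ × ℤ
      ι x = x , 0ℤ

      u u⁻¹ : ℤ × ℤ
      u   = 0ℤ , 1ℤ
      u⁻¹ = h , - 1ℤ

      -- A semiring suffices for the binomial theorem and the laws of powers; subtraction takes
      -- place in the integer coordinates.
      commutativeSemiring : CommutativeSemiring 0ℓ 0ℓ
      commutativeSemiring = record
        { Carrier = ℤ × ℤ
        ; _≈_ = _≋_
        ; _+_ = _⊕_
        ; _*_ = _⊗_
        ; 0#  = ι 0ℤ
        ; 1#  = ι 1ℤ
        ; isCommutativeSemiring = isCommutativeSemiringˡ record
          { +-isCommutativeMonoid = record
            { isMonoid = record
              { isSemigroup = record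
                { isMagma = record
                  { isEquivalence = isEquiv
                  ; ∙-cong = λ (a & b) (c & d) → +-cong a c & +-cong b d
                  }
                ; assoc = λ (x , y) (z , w) (s , t) → ≡⇒≋ (ℤ.+-assoc x z s) (ℤ.+-assoc y w t)
                }
              ; identity = (λ (x , y) → ≡⇒≋ (ℤ.+-identityˡ x) (ℤ.+-identityˡ y))
                         , (λ (x , y) → ≡⇒≋ (ℤ.+-identityʳ x) (ℤ.+-identityʳ y))
              }
            ; comm = λ (x , y) (z , w) → ≡⇒≋ (ℤ.+-comm x z) (ℤ.+-comm y w)
            }
          ; *-isCommutativeMonoid = record
            { isMonoid = record
              { isSemigroup = record
                { isMagma = record
                  { isEquivalence = isEquiv
                  ; ∙-cong = λ (a & b) (c & d) →
                        +-cong (*-cong a c) (-‿cong (*-cong b d))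
                      & +-cong (+-cong (*-cong a d) (*-cong b c)) (*-congˡ h (*-cong b d))
                  }
                ; assoc = λ (x , y) (z , w) (s , t) → ≡⇒≋ (assoc₁ h x y z w s t) (assoc₂ h x y z w s t)
                }
              ; identity = (λ (x , y) → ≡⇒≋ (idˡ₁ x y) (idˡ₂ h x y))
                         , (λ (x , y) → ≡⇒≋ (idʳ₁ x y) (idʳ₂ h x y))
              }
            ; comm = λ (x , y) (z , w) → ≡⇒≋ (comm₁ x y z w) (comm₂ h x y z w)
            }
          ; distribʳ = λ (x , y) (z , w) (s , t) → ≡⇒≋ (distrib₁ x y z w s t) (distrib₂ h x y z w s t)
          ; zeroˡ = λ (x , y) → ≡⇒≋ refl (zero₂ h x y)
          }
        }
        where
        isEquiv : IsEquivalence _≋_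
        isEquiv = record
          { refl  = ≈-refl & ≈-refl
          ; sym   = λ (a & b) → ≈-sym a & ≈-sym b
          ; trans = λ (a & b) (c & d) → ≈-trans a c & ≈-trans b d
          }

        assoc₁ : ∀ h x y z w s t →
          (x * z - y * w) * s - (x * w + y * z + h * (y * w)) * t
            ≡ x * (z * s - w * t) - y * (z * t + w * s + h * (w * t))
        assoc₁ = solve-∀

        assoc₂ : ∀ h x y z w s t →
          (x * z - y * w) * t + (x * w + y * z + h * (y * w)) * s + h * ((x * w + y * z + h * (y * w)) * t)
            ≡ x * (z * t + w * s + h * (w * t)) + y * (z * s - w * t) + h * (y * (z * t + w * s + h * (w * t)))
        assoc₂ = solve-∀

        idˡ₁ : ∀ x y → 1ℤ * x - 0ℤ * y ≡ x
        idˡ₁ = solve-∀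

        idˡ₂ : ∀ h x y → 1ℤ * y + 0ℤ * x + h * (0ℤ * y) ≡ y
        idˡ₂ = solve-∀

        idʳ₁ : ∀ x y → x * 1ℤ - y * 0ℤ ≡ x
        idʳ₁ = solve-∀

        idʳ₂ : ∀ h x y → x * 0ℤ + y * 1ℤ + h * (y * 0ℤ) ≡ y
        idʳ₂ = solve-∀

        comm₁ : ∀ x y z w → x * z - y * w ≡ z * x - w * y
        comm₁ = solve-∀

        comm₂ : ∀ h x y z w → x * w + y * z + h * (y * w) ≡ z * y + w * x + h * (w * y)
        comm₂ = solve-∀

        distrib₁ : ∀ x y z w s t → (z + s) * x - (w + t) * y ≡ (z * x - w * y) + (s * x - t * y)
        distrib₁ = solve-∀

        distrib₂ : ∀ h x y z w s t →
          (z + s) * y + (w + t) * x + h * ((w + t) * y)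
            ≡ (z * y + w * x + h * (w * y)) + (s * y + t * x + h * (t * y))
        distrib₂ = solve-∀

        zero₂ : ∀ h x y → 0ℤ * y + 0ℤ * x + h * (0ℤ * y) ≡ 0ℤ
        zero₂ = solve-∀

  -- Arithmetic modulo a prime.

  module PrimeModulus (p : ℕ) (pr : Prime p) where

    open Modular p public

    euclid : ∀ x y → + p ∣ x * y → + p ∣ x ⊎ + p ∣ y
    euclid x y d = Sum.map ∣ᵤ⇒∣ ∣ᵤ⇒∣
      (euclidsLemma ℤ.∣ x ∣ ℤ.∣ y ∣ pr (subst (p ℕ∣.∣_) (ℤ.abs-* x y) (∣⇒∣ᵤ d)))

    *-cancelˡ : ∀ c {x y} → ¬ + p ∣ c → c * x ≈ c * y → x ≈ y
    *-cancelˡ c {x} {y} p∤c (mod d) with euclid c (x - y) (subst (+ p ∣_) (eq c x y) d)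
      where
      eq : ∀ c x y → c * x - c * y ≡ c * (x - y)
      eq = solve-∀
    ... | inj₁ p∣c   = contradiction p∣c p∤c
    ... | inj₂ p∣x-y = mod p∣x-y

    n<p⇒p∤n : ∀ {n} → 0 < n → n < p → ¬ + p ∣ + n
    n<p⇒p∤n {suc n} _ n<p d = ℕ∣.>⇒∤ n<p (∣⇒∣ᵤ d)

    1<p : 1 < p
    1<p = ℕ.nonTrivial⇒n>1 p {{prime⇒nonTrivial pr}}

    p∤1 : ¬ + p ∣ 1ℤ
    p∤1 = n<p⇒p∤n (s≤s z≤n) 1<p

    -- The p-th power map on the quadratic extension, and Fermat's little theorem.

    module Frobenius (h : ℤ) where
      open Quadratic h public
      module K = CommutativeSemiring commutativeSemiring
      open Algebra.Properties.Semiring.Exp K.semiring public using (^-homo-*; ^-assocʳ; ^-congˡ)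
        renaming (_^_ to _↑_)
      open Algebra.Properties.CommutativeSemiring.Exp commutativeSemiring public
        using () renaming (^-distrib-* to ^-distrib-⊗)
      open Algebra.Properties.Semiring.Mult K.semiring renaming (_×_ to _·_) using ()
      open SetoidReasoning K.setoid

      ι-cong : ∀ {x y} → x ≈ y → ι x ≋ ι y
      ι-cong x≈y = x≈y & ≈-refl

      ι-* : ∀ x s → ι x ⊗ s ≋ (x * proj₁ s , x * proj₂ s)
      ι-* x (y , z) = ≡⇒≋ (eq₁ x y z) (eq₂ h x y z)
        where
        eq₁ : ∀ x y z → x * y - 0ℤ * z ≡ x * y
        eq₁ = solve-∀
        eq₂ : ∀ h x y z → x * z + 0ℤ * y + h * (0ℤ * z) ≡ x * z
        eq₂ = solve-∀

      ι-^ : ∀ x n → ι x ↑ n ≋ ι (x ^ n)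
      ι-^ x zero    = K.refl
      ι-^ x (suc n) = begin
        ι x ⊗ ι x ↑ n      ≈⟨ K.*-congˡ {ι x} (ι-^ x n) ⟩
        ι x ⊗ ι (x ^ n)    ≈⟨ ι-* x _ ⟩
        (x * x ^ n , x * 0ℤ) ≈⟨ ≡⇒≋ refl (ℤ.*-zeroʳ x) ⟩
        ι (x * x ^ n)      ∎

      ·-scalar : ∀ n s → n · s ≋ (+ n * proj₁ s , + n * proj₂ s)
      ·-scalar zero    s       = K.refl
      ·-scalar (suc n) s@(x , y) = K.trans (K.+-congˡ {s} (·-scalar n s))
        (≡⇒≋ (sym (ℤ.suc-* (+ n) x)) (sym (ℤ.suc-* (+ n) y)))

      char : ∀ s → p · s ≋ ι 0ℤ
      char s@(x , y) = K.trans (·-scalar p s)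
        (∣⇒≈0 (ℤ∣.∣m⇒∣m*n x ℤ∣.∣-refl) & ∣⇒≈0 (ℤ∣.∣m⇒∣m*n y ℤ∣.∣-refl))

      [s+t]^p : ∀ s t → (s ⊕ t) ↑ p ≋ s ↑ p ⊕ t ↑ p
      [s+t]^p = FreshmansDream.[x+y]^p≈x^p+y^p commutativeSemiring pr char

      u⁻¹u : u⁻¹ ⊗ u ≋ ι 1ℤ
      u⁻¹u = ≡⇒≋ (eq₁ h) (eq₂ h)
        where
        eq₁ : ∀ h → h * 0ℤ - (- 1ℤ) * 1ℤ ≡ 1ℤ
        eq₁ = solve-∀
        eq₂ : ∀ h → h * 1ℤ + (- 1ℤ) * 0ℤ + h * ((- 1ℤ) * 1ℤ) ≡ 0ℤ
        eq₂ = solve-∀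

      -- u is a unit, so it cancels even when the ring has zero divisors.
      cancel-u : ∀ s t → u ⊗ s ≋ u ⊗ t → s ≋ t
      cancel-u s t us≋ut = begin
        s               ≈⟨ K.*-identityˡ s ⟨
        ι 1ℤ ⊗ s        ≈⟨ K.*-congʳ {s} u⁻¹u ⟨
        u⁻¹ ⊗ u ⊗ s     ≈⟨ K.*-assoc u⁻¹ u s ⟩
        u⁻¹ ⊗ (u ⊗ s)   ≈⟨ K.*-congˡ {u⁻¹} us≋ut ⟩
        u⁻¹ ⊗ (u ⊗ t)   ≈⟨ K.*-assoc u⁻¹ u t ⟨
        u⁻¹ ⊗ u ⊗ t     ≈⟨ K.*-congʳ {t} u⁻¹u ⟩
        ι 1ℤ ⊗ t        ≈⟨ K.*-identityˡ t ⟩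
        t               ∎


    [x+1]^p : ∀ x → (x + 1ℤ) ^ p ≈ x ^ p + 1ℤ
    [x+1]^p x = ≋₁ (begin
      ι ((x + 1ℤ) ^ p)         ≈⟨ ι-^ (x + 1ℤ) p ⟨
      (ι x ⊕ ι 1ℤ) ↑ p         ≈⟨ [s+t]^p (ι x) (ι 1ℤ) ⟩
      ι x ↑ p ⊕ ι 1ℤ ↑ p       ≈⟨ K.+-cong (ι-^ x p) (ι-^ 1ℤ p) ⟩
      ι (x ^ p) ⊕ ι (1ℤ ^ p)   ≈⟨ K.+-congˡ {ι (x ^ p)} (ι-cong (≡⇒≈ (ℤ.^-zeroˡ p))) ⟩
      ι (x ^ p) ⊕ ι 1ℤ         ∎)
      where
      -- Only constants occur, and h does not affect their products; 0 is an arbitrary choice.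
      open Frobenius 0ℤ
      open SetoidReasoning K.setoid

    -- Induction outward from 0 in both directions, since xᵖ grows by 1 with x.
    fermat : ∀ x → x ^ p ≈ x
    fermat (+ zero)  = ≡⇒≈ (0^n p (ℕ.<⇒≤ 1<p))
      where
      0^n : ∀ n → 0 < n → 0ℤ ^ n ≡ 0ℤ
      0^n (suc n) _ = refl
    fermat (+ suc n) = begin
      (+ suc n) ^ p     ≡⟨ cong (λ m → (+ m) ^ p) (ℕ.+-comm 1 n) ⟩
      (+ n + 1ℤ) ^ p    ≈⟨ [x+1]^p (+ n) ⟩
      (+ n) ^ p + 1ℤ    ≈⟨ +-congʳ 1ℤ (fermat (+ n)) ⟩
      + n + 1ℤ          ≡⟨ cong +_ (ℕ.+-comm n 1) ⟩
      + suc n           ∎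
      where open SetoidReasoning ≈-setoid
    fermat -[1+ n ]  = begin
      x ^ p                 ≡⟨ shift (x ^ p) ⟩
      (x ^ p + 1ℤ) - 1ℤ     ≈⟨ +-congʳ (- 1ℤ) ([x+1]^p x) ⟨
      (x + 1ℤ) ^ p - 1ℤ     ≈⟨ +-congʳ (- 1ℤ) (previous n) ⟩
      (x + 1ℤ) - 1ℤ         ≡⟨ shift x ⟨
      x                     ∎
      where
      open SetoidReasoning ≈-setoid
      x = -[1+ n ]
      previous : ∀ n → (-[1+ n ] + 1ℤ) ^ p ≈ -[1+ n ] + 1ℤ
      previous zero    = fermat (+ 0)
      previous (suc n) = fermat -[1+ n ]
      shift : ∀ x → x ≡ (x + 1ℤ) - 1ℤ
      shift = solve-∀

    ∑≤-cong-≈ : ∀ n {f g} → (∀ k → k ≤ n → f k ≈ g k) → ∑≤ n f ≈ ∑≤ n g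
    ∑≤-cong-≈ zero    f≈g = f≈g 0 z≤n
    ∑≤-cong-≈ (suc n) f≈g = +-cong (∑≤-cong-≈ n (λ k k≤n → f≈g k (ℕ.m≤n⇒m≤1+n k≤n))) (f≈g (suc n) ℕ.≤-refl)

    -- The binomial sum as a Morgan-Voyce polynomial modulo p.

    -- For n = [p/3], p is 3n+1 or 3n+2; divisibility of the product treats both cases together.
    module _ (n : ℕ) (3n<p : 3 ℕ.* n < p) (p∣[3n+1][3n+2] : + p ∣ + ((1 ℕ.+ 3 ℕ.* n) ℕ.* (2 ℕ.+ 3 ℕ.* n))) where

      private
        -- since (3k+1)(3k+2) + 9 (n+k+1)(n-k) = (3n+1)(3n+2)
        F-factor≈-27*G-factor : ∀ k → k ≤ n →
          + (3 ℕ.* (1 ℕ.+ 3 ℕ.* k) ℕ.* (2 ℕ.+ 3 ℕ.* k)) ≈ - + 27 * + (suc (n ℕ.+ k) ℕ.* (n ∸ k))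
        F-factor≈-27*G-factor k k≤n = mod (subst (+ p ∣_) (sym (begin
            + f - (- + 27 * + g)         ≡⟨ neg (+ f) (+ g) ⟩
            + f + + 27 * + g             ≡⟨ cong (λ s → + f + s) (ℤ.pos-* 27 g) ⟨
            + (f ℕ.+ 27 ℕ.* g)           ≡⟨ cong +_ f+27g ⟩
            + (3 ℕ.* ((1 ℕ.+ 3 ℕ.* n) ℕ.* (2 ℕ.+ 3 ℕ.* n)))
                                         ≡⟨ ℤ.pos-* 3 ((1 ℕ.+ 3 ℕ.* n) ℕ.* (2 ℕ.+ 3 ℕ.* n)) ⟩
            + 3 * + ((1 ℕ.+ 3 ℕ.* n) ℕ.* (2 ℕ.+ 3 ℕ.* n)) ∎))
          (ℤ∣.∣n⇒∣m*n (+ 3) p∣[3n+1][3n+2]))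
          where
          open ≡-Reasoning
          f = 3 ℕ.* (1 ℕ.+ 3 ℕ.* k) ℕ.* (2 ℕ.+ 3 ℕ.* k)
          d = n ∸ k
          g = suc (n ℕ.+ k) ℕ.* d
          -- n is written as k + d, which removes the truncated subtraction n ∸ k.
          sum-ℕ : ∀ k d →
            3 ℕ.* (1 ℕ.+ 3 ℕ.* k) ℕ.* (2 ℕ.+ 3 ℕ.* k) ℕ.+ 27 ℕ.* ((1 ℕ.+ ((k ℕ.+ d) ℕ.+ k)) ℕ.* d)
              ≡ 3 ℕ.* ((1 ℕ.+ 3 ℕ.* (k ℕ.+ d)) ℕ.* (2 ℕ.+ 3 ℕ.* (k ℕ.+ d)))
          sum-ℕ = ℕSolver.solve-∀
          f+27g : f ℕ.+ 27 ℕ.* g ≡ 3 ℕ.* ((1 ℕ.+ 3 ℕ.* n) ℕ.* (2 ℕ.+ 3 ℕ.* n))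
          f+27g = subst (λ N → f ℕ.+ 27 ℕ.* (suc (N ℕ.+ k) ℕ.* d) ≡ 3 ℕ.* ((1 ℕ.+ 3 ℕ.* N) ℕ.* (2 ℕ.+ 3 ℕ.* N)))
                        (ℕ.m+[n∸m]≡n k≤n) (sum-ℕ k d)
          neg : ∀ x y → x - (- + 27 * y) ≡ x + + 27 * y
          neg = solve-∀

        F≈[-27]^k*G : ∀ k → k ≤ n → + F k ≈ (- + 27) ^ k * + G n k
        F≈[-27]^k*G zero    _   = ≈-refl
        F≈[-27]^k*G (suc k) k<n = begin
          + F (suc k)                                       ≡⟨ ℤ.pos-* (F k) _ ⟩
          + F k * + _                                       ≈⟨ *-cong (F≈[-27]^k*G k k≤n) (F-factor≈-27*G-factor k k≤n) ⟩
          ((- + 27) ^ k * + G n k) * (- + 27 * + g)         ≡⟨ eq ((- + 27) ^ k) (+ G n k) (- + 27) (+ g) ⟩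
          (- + 27 * (- + 27) ^ k) * (+ G n k * + g)         ≡⟨ cong ((- + 27) ^ suc k *_) (ℤ.pos-* (G n k) g) ⟨
          (- + 27) ^ suc k * + G n (suc k)                  ∎
          where
          open SetoidReasoning ≈-setoid
          k≤n = ℕ.<⇒≤ k<n
          g = suc (n ℕ.+ k) ℕ.* (n ∸ k)
          eq : ∀ x y z w → (x * y) * (z * w) ≡ (z * x) * (y * w)
          eq = solve-∀

      -- Multiplied by (2k)!, the two sides become `F k` and (-27)ᵏ `G n k`; the factor (2k)!
      -- cancels because 2k ≤ 3n < p.
      [3k]Ck≈[-27]^k*β : ∀ k → k ≤ n → + ((3 ℕ.* k) C k) ≈ (- + 27) ^ k * + ((n ℕ.+ k) C (2 ℕ.* k))
      [3k]Ck≈[-27]^k*β k k≤n = *-cancelˡ (+ f) p∤f (begin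
        + f * + ((3 ℕ.* k) C k)               ≡⟨ ℤ.*-comm (+ f) (+ ((3 ℕ.* k) C k)) ⟩
        + ((3 ℕ.* k) C k) * + f               ≡⟨ ℤ.pos-* ((3 ℕ.* k) C k) f ⟨
        + (((3 ℕ.* k) C k) ℕ.* f)             ≡⟨ cong +_ ([3k]Ck*[2k]! k) ⟩
        + F k                                 ≈⟨ F≈[-27]^k*G k k≤n ⟩
        (- + 27) ^ k * + G n k                ≡⟨ cong (λ x → (- + 27) ^ k * + x) (β*[2k]! n k k≤n) ⟨
        (- + 27) ^ k * + (β n k ℕ.* f)        ≡⟨ cong ((- + 27) ^ k *_) (ℤ.pos-* (β n k) f) ⟩
        (- + 27) ^ k * (+ β n k * + f)        ≡⟨ eq ((- + 27) ^ k) (+ β n k) (+ f) ⟩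
        + f * ((- + 27) ^ k * + β n k)        ∎)
        where
        open SetoidReasoning ≈-setoid
        f = (2 ℕ.* k) !
        p∤f : ¬ + p ∣ + f
        p∤f d = prime∤k! pr (2 ℕ.* k)
          (ℕ.≤-<-trans (ℕ.≤-trans (ℕ.*-monoʳ-≤ 2 k≤n) (ℕ.*-monoˡ-≤ n {2} {3} (s≤s (s≤s z≤n)))) 3n<p) (∣⇒∣ᵤ d)
        eq : ∀ x y z → x * (y * z) ≡ z * (x * y)
        eq = solve-∀

      ∑[3k]Ck*a^k≈b : ∀ a → ∑≤ n (λ k → + ((3 ℕ.* k) C k) * a ^ k) ≈ b (- + 27 * a) n
      ∑[3k]Ck*a^k≈b a = ≈-trans
        (∑≤-cong-≈ n (λ k k≤n → ≈-trans (*-congʳ (a ^ k) ([3k]Ck≈[-27]^k*β k k≤n)) (≡⇒≈ (regroup k))))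
        (≡⇒≈ (∑β≡b (- + 27 * a) n n ℕ.≤-refl))
        where
        eq : ∀ x y z → x * y * z ≡ y * (x * z)
        eq = solve-∀
        regroup : ∀ k → (- + 27) ^ k * + β n k * a ^ k ≡ + β n k * (- + 27 * a) ^ k
        regroup k = trans (eq ((- + 27) ^ k) (+ β n k) (a ^ k))
                          (cong (+ β n k *_) (sym (^-distrib-* (- + 27) a k)))

    -- Lagrange's bound on the number of roots.

    -- Induction on the degree: dividing by x - r 0 leaves a monic quotient, at which the remaining
    -- roots vanish because p is prime and divides no difference of roots. In degree 0 the
    -- polynomial is 1.
    ¬too-many-roots : ∀ d cs → length cs ≡ d → (r : ℕ → ℤ) →
      (∀ i → i ≤ d → + p ∣ monic cs (r i)) →
      ¬ (∀ i j → i < j → j ≤ d → ¬ + p ∣ r j - r i)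
    ¬too-many-roots zero    []       _   r root distinct = p∤1 (root 0 z≤n)
    ¬too-many-roots (suc d) (c ∷ cs) len r root distinct =
      ¬too-many-roots d (quotient (r 0) cs) (trans (quotient-length (r 0) cs) (ℕ.suc-injective len))
        (r ∘ suc) root′ (λ i j i<j j≤d → distinct (suc i) (suc j) (s≤s i<j) (s≤s j≤d))
      where
      root′ : ∀ i → i ≤ d → + p ∣ monic (quotient (r 0) cs) (r (suc i))
      root′ i i≤d with euclid (r (suc i) - r 0) _
        (subst (+ p ∣_) (monic-difference (r 0) c cs (r (suc i)))
          (ℤ∣.∣m∣n⇒∣m-n (root (suc i) (s≤s i≤d)) (root 0 z≤n)))
      ... | inj₁ p∣r-r₀ = contradiction p∣r-r₀ (distinct 0 (suc i) (s≤s z≤n) (s≤s i≤d))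
      ... | inj₂ p∣q    = p∣q

    -- The cubic relation for Morgan-Voyce polynomials.

    module _ (y : ℤ) (n : ℕ) where
      open Frobenius (y + + 2)
      open SetoidReasoning K.setoid

      private
        -- `Q` is `P` with its coordinates swapped. The swap sends s to u times the conjugate of s,
        -- hence uⁿ⁺¹ to u · u⁻ⁿ⁻¹ = u⁻ⁿ.
        P Q : ℤ × ℤ
        P = b y n - B y n , B y n
        Q = B y n , b y n - B y n

      -- Multiplication by u in the basis 1, u is the recurrence of `b` and `B`.
      u^[1+n] : ∀ n → u ↑ suc n ≋ (b y n - B y n , B y n)
      u^[1+n] zero    = K.*-identityʳ u
      u^[1+n] (suc n) = begin
        u ⊗ u ↑ suc n                       ≈⟨ K.*-congˡ {u} (u^[1+n] n) ⟩
        u ⊗ (b y n - B y n , B y n)         ≈⟨ ≡⇒≋ (eq₁ y (b y n) (B y n)) (eq₂ y (b y n) (B y n)) ⟩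
        (b y (suc n) - B y (suc n) , B y (suc n)) ∎
        where
        eq₁ : ∀ y c d → 0ℤ * (c - d) - 1ℤ * d ≡ (c + y * d) - ((c + y * d) + d)
        eq₁ = solve-∀
        eq₂ : ∀ y c d → 0ℤ * d + 1ℤ * (c - d) + (y + + 2) * (1ℤ * d) ≡ (c + y * d) + d
        eq₂ = solve-∀

      private
        -- The left-hand side is the norm x² + h x y + y² of uⁿ⁺¹ = (b - B) + B u, and u has norm 1.
        norm : ∀ n → b y n * b y n + y * b y n * B y n - y * B y n * B y n ≡ 1ℤ
        norm zero    = eq y
          where
          eq : ∀ y → 1ℤ * 1ℤ + y * 1ℤ * 1ℤ - y * 1ℤ * 1ℤ ≡ 1ℤ
          eq = solve-∀
        norm (suc n) = trans (eq y (b y n) (B y n)) (norm n)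
          where
          eq : ∀ y c d → (c + y * d) * (c + y * d) + y * (c + y * d) * (c + y * d + d) - y * (c + y * d + d) * (c + y * d + d)
            ≡ c * c + y * c * d - y * d * d
          eq = solve-∀

        PQ≋u : P ⊗ Q ≋ u
        PQ≋u = ≡⇒≋ (eq₁ (b y n) (B y n)) (trans (eq₂ y (b y n) (B y n)) (norm n))
          where
          eq₁ : ∀ c d → (c - d) * d - d * (c - d) ≡ 0ℤ
          eq₁ = solve-∀
          eq₂ : ∀ y c d → (c - d) * (c - d) + d * d + (y + + 2) * (d * (c - d)) ≡ c * c + y * c * d - y * d * d
          eq₂ = solve-∀

        P⊕Q≋b[1+u] : P ⊕ Q ≋ (b y n , b y n)
        P⊕Q≋b[1+u] = ≡⇒≋ (eq₁ (b y n) (B y n)) (eq₂ (b y n) (B y n))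
          where
          eq₁ : ∀ c d → c - d + d ≡ c
          eq₁ = solve-∀
          eq₂ : ∀ c d → d + (c - d) ≡ c
          eq₂ = solve-∀

        P³Q³≋u³ : P ↑ 3 ⊗ Q ↑ 3 ≋ u ↑ 3
        P³Q³≋u³ = K.trans (K.sym (^-distrib-⊗ P Q 3)) (^-congˡ 3 PQ≋u)

        P³≋u⇒Q³≋u² : P ↑ 3 ≋ u → Q ↑ 3 ≋ u ↑ 2
        P³≋u⇒Q³≋u² P³≋u = cancel-u (Q ↑ 3) (u ↑ 2) (K.trans (K.*-congʳ {Q ↑ 3} (K.sym P³≋u)) P³Q³≋u³)

        P³≋u²⇒Q³≋u : P ↑ 3 ≋ u ↑ 2 → Q ↑ 3 ≋ u
        P³≋u²⇒Q³≋u P³≋u² = K.trans (cancel-u (Q ↑ 3) (u ↑ 1) (cancel-u (u ⊗ Q ↑ 3) (u ⊗ u ↑ 1) (begin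
          u ⊗ (u ⊗ Q ↑ 3)     ≈⟨ K.*-assoc u u (Q ↑ 3) ⟨
          u ⊗ u ⊗ Q ↑ 3       ≈⟨ K.*-congʳ {Q ↑ 3} (K.*-congˡ {u} (K.*-identityʳ u)) ⟨
          u ↑ 2 ⊗ Q ↑ 3       ≈⟨ K.*-congʳ {Q ↑ 3} P³≋u² ⟨
          P ↑ 3 ⊗ Q ↑ 3       ≈⟨ P³Q³≋u³ ⟩
          u ↑ 3               ∎))) (K.*-identityʳ u)

        -- As P³Q³ = u³, one cube is u and the other u²; the two alternatives only exchange them.
        P³⊕Q³ : u ↑ (suc n ℕ.* 3) ≋ u ⊎ u ↑ (suc n ℕ.* 3) ≋ u ↑ 2 → P ↑ 3 ⊕ Q ↑ 3 ≋ u ⊕ u ↑ 2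
        P³⊕Q³ (inj₁ eq) = K.+-cong P³≋u (P³≋u⇒Q³≋u² P³≋u)
          where
          P³≋u : P ↑ 3 ≋ u
          P³≋u = K.trans (^-congˡ 3 (K.sym (u^[1+n] n))) (K.trans (^-assocʳ u (suc n) 3) eq)
        P³⊕Q³ (inj₂ eq) = K.trans (K.+-cong P³≋u² (P³≋u²⇒Q³≋u P³≋u²)) (K.+-comm (u ↑ 2) u)
          where
          P³≋u² : P ↑ 3 ≋ u ↑ 2
          P³≋u² = K.trans (^-congˡ 3 (K.sym (u^[1+n] n))) (K.trans (^-assocʳ u (suc n) 3) eq)

      -- With P = uⁿ⁺¹ and Q = u⁻ⁿ, P + Q = bₙ (1 + u) and P Q = u; the equation is the constant
      -- coefficient of (P + Q)³ = P³ + Q³ + 3 P Q (P + Q).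
      b-cubic : u ↑ (suc n ℕ.* 3) ≋ u ⊎ u ↑ (suc n ℕ.* 3) ≋ u ↑ 2 →
        (y + + 4) * (b y n * b y n * b y n) ≈ + 3 * b y n + 1ℤ
      -- From (1 + u)² = (y + 4) u the left side is (y + 4) bₙ³ (u + u²) and the right side (1 + 3
      -- bₙ)(u + u²). The constant coefficient of u + u² is -1, hence the negation. For arbitrary y
      -- the factor u + u² may be a zero divisor, so a coefficient is compared instead.
      b-cubic hyp = ≈-trans (≡⇒≈ (eq₁ y c)) (≈-trans (-‿cong (≋₁ expansion)) (≡⇒≈ (eq₂ c)))
        where
        c = b y n
        s = (c , c)
        PQ[P⊕Q] : (P ⊗ Q) ⊗ (P ⊕ Q) ≋ u ⊗ s
        PQ[P⊕Q] = K.*-cong PQ≋u P⊕Q≋b[1+u]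
        expansion : s ↑ 3 ≋ (u ⊕ u ⊗ u) ⊕ (u ⊗ s ⊕ (u ⊗ s ⊕ u ⊗ s))
        expansion = K.trans (^-congˡ 3 (K.sym P⊕Q≋b[1+u])) (K.trans ([x+y]³ commutativeSemiring P Q)
          (K.+-cong (K.trans (P³⊕Q³ hyp) (K.+-congˡ {u} (K.*-congˡ {u} (K.*-identityʳ u)))) (K.+-cong PQ[P⊕Q] (K.+-cong PQ[P⊕Q] PQ[P⊕Q]))))
        eq₁ : ∀ y c → (y + + 4) * (c * c * c) ≡
          - (c * (c * (c * 1ℤ - c * 0ℤ) - c * (c * 0ℤ + c * 1ℤ + (y + + 2) * (c * 0ℤ)))
           - c * (c * (c * 0ℤ + c * 1ℤ + (y + + 2) * (c * 0ℤ)) + c * (c * 1ℤ - c * 0ℤ)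
                  + (y + + 2) * (c * (c * 0ℤ + c * 1ℤ + (y + + 2) * (c * 0ℤ)))))
        eq₁ = solve-∀
        eq₂ : ∀ c → - ((0ℤ + - 1ℤ) + ((0ℤ * c - 1ℤ * c) + ((0ℤ * c - 1ℤ * c) + (0ℤ * c - 1ℤ * c)))) ≡ + 3 * c + 1ℤ
        eq₂ = solve-∀

    -- Powers with exponent m = (p-1)/2, and uᵖ in terms of the discriminant.

    module OddPrime (m : ℕ) (p≡1+2m : p ≡ suc (2 ℕ.* m)) where

      p∤2 : ¬ + p ∣ + 2
      p∤2 = n<p⇒p∤n (s≤s z≤n) (2<p m p≡1+2m)
        where
        2<p : ∀ m → p ≡ suc (2 ℕ.* m) → 2 < p
        2<p zero    refl = contradiction 1<p (ℕ.<-irrefl refl)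
        2<p (suc m) refl = s≤s (ℕ.*-monoʳ-≤ 2 (s≤s z≤n))

      1≉-1 : ¬ 1ℤ ≈ - 1ℤ
      1≉-1 (mod d) = p∤2 d

      x^2m≈1 : ∀ x → ¬ + p ∣ x → (x * x) ^ m ≈ 1ℤ
      x^2m≈1 x p∤x = *-cancelˡ x p∤x (begin
        x * (x * x) ^ m       ≡⟨ cong (λ y → x * (x * y) ^ m) (ℤ.*-identityʳ x) ⟨
        x * (x ^ 2) ^ m       ≡⟨ cong (x *_) (ℤ.^-*-assoc x 2 m) ⟩
        x ^ suc (2 ℕ.* m)     ≡⟨ cong (x ^_) p≡1+2m ⟨
        x ^ p                 ≈⟨ fermat x ⟩
        x                     ≡⟨ ℤ.*-identityʳ x ⟨
        x * 1ℤ                ∎)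
        where open SetoidReasoning ≈-setoid

      module _ (h : ℤ) where
        open Frobenius h

        private
          Δ^m : ℤ
          Δ^m = (h * h - + 4) ^ m

          √Δ : ℤ × ℤ
          √Δ = - h , + 2

        -- (2u - h)ᵖ computed additively, by the freshman's dream, and multiplicatively, from (2u - h)² = h² - 4.
        2u^p-h : ι (+ 2) ⊗ u ↑ p ⊕ ι (- h) ≋ (Δ^m * - h , Δ^m * + 2)
        2u^p-h = begin
          ι (+ 2) ⊗ u ↑ p ⊕ ι (- h)
            ≈⟨ K.+-cong (K.*-congʳ {u ↑ p} (ι^p (+ 2))) (ι^p (- h)) ⟨
          ι (+ 2) ↑ p ⊗ u ↑ p ⊕ ι (- h) ↑ p
            ≈⟨ K.+-congʳ (^-distrib-⊗ (ι (+ 2)) u p) ⟨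
          (ι (+ 2) ⊗ u) ↑ p ⊕ ι (- h) ↑ p
            ≈⟨ [s+t]^p (ι (+ 2) ⊗ u) (ι (- h)) ⟨
          (ι (+ 2) ⊗ u ⊕ ι (- h)) ↑ p
            ≈⟨ ^-congˡ p (≡⇒≋ (ℤ.+-identityˡ (- h)) (eq₀ h)) ⟩
          √Δ ↑ p
            ≡⟨ cong (√Δ ↑_) p≡1+2m ⟩
          √Δ ⊗ √Δ ↑ (2 ℕ.* m)
            ≈⟨ K.*-congˡ {√Δ} (^-assocʳ √Δ 2 m) ⟨
          √Δ ⊗ (√Δ ↑ 2) ↑ m
            ≈⟨ K.*-congˡ {√Δ} (^-congˡ m square) ⟩
          √Δ ⊗ ι (h * h - + 4) ↑ m
            ≈⟨ K.*-congˡ {√Δ} (ι-^ (h * h - + 4) m) ⟩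
          √Δ ⊗ ι Δ^m
            ≈⟨ K.*-comm √Δ (ι Δ^m) ⟩
          ι Δ^m ⊗ √Δ
            ≈⟨ ι-* Δ^m √Δ ⟩
          (Δ^m * - h , Δ^m * + 2)
            ∎
          where
          open SetoidReasoning K.setoid
          ι^p : ∀ x → ι x ↑ p ≋ ι x
          ι^p x = K.trans (ι-^ x p) (ι-cong (fermat x))
          eq₀ : ∀ h → + 2 * 1ℤ + 0ℤ * 0ℤ + h * (0ℤ * 1ℤ) + 0ℤ ≡ + 2
          eq₀ = solve-∀
          eq₁ : ∀ h → (- h) * (- h) - + 2 * + 2 ≡ h * h - + 4
          eq₁ = solve-∀
          eq₂ : ∀ h → (- h) * + 2 + + 2 * (- h) + h * (+ 2 * + 2) ≡ 0ℤ
          eq₂ = solve-∀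
          square : √Δ ↑ 2 ≋ ι (h * h - + 4)
          square = K.trans (K.*-congˡ {√Δ} (K.*-identityʳ √Δ)) (≡⇒≋ (eq₁ h) (eq₂ h))

        -- Coordinates of 2uᵖ = h + Δᵐ (2u - h). The first stays doubled until Δᵐ is known to be 1
        -- or -1, when h (1 - Δᵐ) is visibly twice an integer.
        2u^p : (+ 2 * proj₁ (u ↑ p) ≈ h * (1ℤ - Δ^m)) × proj₂ (u ↑ p) ≈ Δ^m
        2u^p = ≈-trans (≡⇒≈ (eq₁ h c)) (≈-trans (+-congʳ h (≋₁ s)) (≡⇒≈ (eq₂ h Δ^m)))
             , *-cancelˡ (+ 2) p∤2 (≈-trans (≡⇒≈ (sym (ℤ.+-identityʳ (+ 2 * d)))) (≈-trans (≋₂ s) (≡⇒≈ (ℤ.*-comm Δ^m (+ 2)))))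
          where
          c = proj₁ (u ↑ p)
          d = proj₂ (u ↑ p)
          s : (+ 2 * c - h , + 2 * d + 0ℤ) ≋ (Δ^m * - h , Δ^m * + 2)
          s = K.trans (K.+-congʳ {ι (- h)} (K.sym (ι-* (+ 2) (u ↑ p)))) 2u^p-h
          eq₁ : ∀ h c → + 2 * c ≡ + 2 * c - h + h
          eq₁ = solve-∀
          eq₂ : ∀ h e → e * - h + h ≡ h * (1ℤ - e)
          eq₂ = solve-∀

        u^p≋u : Δ^m ≈ 1ℤ → u ↑ p ≋ u
        u^p≋u ε = *-cancelˡ (+ 2) p∤2 (≈-trans (proj₁ 2u^p)
                    (≈-trans (*-congˡ h (+-congˡ 1ℤ (-‿cong ε))) (≡⇒≈ (ℤ.*-zeroʳ h))))
                & ≈-trans (proj₂ 2u^p) ε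

        u^p≋u⁻¹ : Δ^m ≈ - 1ℤ → u ↑ p ≋ u⁻¹
        u^p≋u⁻¹ ε = *-cancelˡ (+ 2) p∤2 (≈-trans (proj₁ 2u^p)
                      (≈-trans (*-congˡ h (+-congˡ 1ℤ (-‿cong ε))) (≡⇒≈ (ℤ.*-comm h (+ 2)))))
                  & ≈-trans (proj₂ 2u^p) ε

      -- For h = -1 the unit u is a primitive cube root of unity and the discriminant is -3.
      module _ where
        open Frobenius (- 1ℤ)
        open SetoidReasoning K.setoid

        private
          u^3n : ∀ n → u ↑ (3 ℕ.* n) ≋ ι 1ℤ
          u^3n n = begin
            u ↑ (3 ℕ.* n)     ≈⟨ ^-assocʳ u 3 n ⟨
            -- With the numeral -1 for h, `u ↑ 3` evaluates to `ι 1ℤ`.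
            ι 1ℤ ↑ n          ≈⟨ ι-^ 1ℤ n ⟩
            ι (1ℤ ^ n)        ≈⟨ ι-cong (≡⇒≈ (ℤ.^-zeroˡ n)) ⟩
            ι 1ℤ              ∎

        -- The second coordinate of uᵖ is Δᵐ = (-3)ᵐ. Since u³ = 1, uᵖ is u or u² = -1 - u according
        -- to p modulo 3, with second coordinate 1 or -1.
        [-3]^m≈1 : ∀ n → p ≡ 1 ℕ.+ 3 ℕ.* n → (- + 3) ^ m ≈ 1ℤ
        [-3]^m≈1 n eq = ≈-trans (≈-sym (proj₂ (2u^p (- 1ℤ)))) (≋₂ (begin
          u ↑ p               ≡⟨ cong (u ↑_) eq ⟩
          u ⊗ u ↑ (3 ℕ.* n)   ≈⟨ K.*-congˡ {u} (u^3n n) ⟩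
          u                   ∎))

        [-3]^m≈-1 : ∀ n → p ≡ 2 ℕ.+ 3 ℕ.* n → (- + 3) ^ m ≈ - 1ℤ
        [-3]^m≈-1 n eq = ≈-trans (≈-sym (proj₂ (2u^p (- 1ℤ)))) (≋₂ (begin
          u ↑ p                     ≡⟨ cong (u ↑_) eq ⟩
          u ⊗ (u ⊗ u ↑ (3 ℕ.* n))   ≈⟨ K.*-congˡ {u} (K.*-congˡ {u} (u^3n n)) ⟩
          u⁻¹                       ∎))

      -- Euler's criterion.

      -- Both factors of j² - i² = (j - i)(j + i) lie strictly between 0 and p = 2m + 1.
      square-injective : ∀ i j → i < j → j ≤ m → ¬ + p ∣ + j * + j - + i * + i
      square-injective i j i<j j≤m d =
        [ n<p⇒p∤n (ℕ.m<n⇒0<n∸m i<j) (ℕ.≤-<-trans (ℕ.m∸n≤m j i) (ℕ.≤-<-trans (ℕ.m≤m+n j i) j+i<p))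
        , n<p⇒p∤n (ℕ.≤-trans (ℕ.≤-trans (s≤s z≤n) i<j) (ℕ.m≤m+n j i)) j+i<p
        ]′ (euclid (+ (j ∸ i)) (+ (j ℕ.+ i)) (subst (+ p ∣_) factor d))
        where
        j+i<p : j ℕ.+ i < p
        j+i<p = subst (j ℕ.+ i <_) (sym p≡1+2m)
          (s≤s (ℕ.+-mono-≤ j≤m (ℕ.≤-trans (ℕ.≤-trans (ℕ.<⇒≤ i<j) j≤m) (ℕ.m≤m+n m 0))))
        eq : ∀ x y → (x + y) * (x + y) - y * y ≡ x * (x + y + y)
        eq = solve-∀
        factor : + j * + j - + i * + i ≡ + (j ∸ i) * + (j ℕ.+ i)
        factor = subst (λ k → + k * + k - + i * + i ≡ + (j ∸ i) * + (k ℕ.+ i))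
          (ℕ.m∸n+n≡m (ℕ.<⇒≤ i<j)) (eq (+ (j ∸ i)) (+ i))

      -- Otherwise x is a root of Xᵐ - 1 besides the m distinct roots 1², …, m².
      nonsquare⇒x^m≉1 : ∀ x → (∀ y → y < p → ¬ x ≈ + y * + y) → ¬ + p ∣ x ^ m - 1ℤ
      nonsquare⇒x^m≉1 x nonsquare p∣x^m-1 = ¬too-many-roots m cs len r root distinct
        where
        r : ℕ → ℤ
        r zero    = x
        r (suc i) = + suc i * + suc i

        m<p : m < p
        m<p = subst (m <_) (sym p≡1+2m) (s≤s (ℕ.m≤m+n m _))

        cs : List ℤ
        -- Xᵐ - 1 without its implicit leading coefficient.
        cs = - 1ℤ ∷ replicate (ℕ.pred m) 0ℤ

        0<m : ∀ m → p ≡ suc (2 ℕ.* m) → 0 < m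
        0<m zero    eq = contradiction 1<p (ℕ.<-irrefl (sym eq))
        0<m (suc m) _  = s≤s z≤n

        1+pred : suc (ℕ.pred m) ≡ m
        1+pred = ℕ.suc-pred m {{ℕ.>-nonZero (0<m m p≡1+2m)}}

        len : length cs ≡ m
        len = trans (cong suc (length-replicate (ℕ.pred m))) 1+pred

        value : ∀ z → z ^ m - 1ℤ ≡ monic cs z
        value z = trans (ℤ.+-comm (z ^ m) (- 1ℤ))
          (cong (λ s → - 1ℤ + s) (trans (cong (z ^_) (sym 1+pred)) (cong (z *_) (sym (monic-0s (ℕ.pred m) z)))))

        root : ∀ i → i ≤ m → + p ∣ monic cs (r i)
        root zero    _   = subst (+ p ∣_) (value x) p∣x^m-1
        root (suc i) i<m = subst (+ p ∣_) (value (r (suc i)))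
          (p∣x-y (x^2m≈1 (+ suc i) (n<p⇒p∤n (s≤s z≤n) (ℕ.≤-<-trans i<m m<p))))

        distinct : ∀ i j → i < j → j ≤ m → ¬ + p ∣ r j - r i
        distinct zero    (suc j) _   j≤m d = nonsquare (suc j) (ℕ.≤-<-trans j≤m m<p) (≈-sym (mod d))
        distinct (suc i) (suc j) i<j j≤m   = square-injective (suc i) (suc j) i<j j≤m

      -- (xᵐ - 1)(xᵐ + 1) = x²ᵐ - 1 vanishes modulo p, and the first factor is excluded by the count
      -- of roots.
      euler : ∀ x → ¬ + p ∣ x → (∀ y → y < p → ¬ x ≈ + y * + y) → x ^ m ≈ - 1ℤ
      euler x p∤x nonsquare = [ (λ d → contradiction d (nonsquare⇒x^m≉1 x nonsquare)) , mod ]′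
        (euclid (x ^ m - 1ℤ) (x ^ m + 1ℤ)
          (subst (+ p ∣_) (trans (cong (_- 1ℤ) (^-distrib-* x x m)) (eq (x ^ m))) (p∣x-y (x^2m≈1 x p∤x))))
        where
        eq : ∀ z → z * z - 1ℤ ≡ (z - 1ℤ) * (z + 1ℤ)
        eq = solve-∀

      -- Uniqueness of the root.

      module _ (a : ℤ) (p∤3 : ¬ + p ∣ + 3)
               (p∤D : ¬ + p ∣ a * (+ 4 - + 27 * a)) (D^m≈-1 : (a * (+ 4 - + 27 * a)) ^ m ≈ - 1ℤ) where

        private
          A : ℤ
          A = + 4 - + 27 * a

          D : ℤ
          D = a * A

          p∤9 : ¬ + p ∣ + 9
          p∤9 d = [ p∤3 , p∤3 ]′ (euclid (+ 3) (+ 3) d)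

          -- The m-th power of a nonzero square is 1, whereas that of 9² D is -1.
          81D≉square : ∀ z → ¬ z * z ≈ + 81 * D
          81D≉square z z²≈81D = 1≉-1 (begin
            1ℤ                   ≈⟨ x^2m≈1 z p∤z ⟨
            (z * z) ^ m          ≈⟨ ^-cong m z²≈81D ⟩
            (+ 81 * D) ^ m       ≡⟨ ^-distrib-* (+ 81) D m ⟩
            (+ 81) ^ m * D ^ m   ≈⟨ *-cong (x^2m≈1 (+ 9) p∤9) D^m≈-1 ⟩
            - 1ℤ                 ∎)
            where
            open SetoidReasoning ≈-setoid
            p∤z : ¬ + p ∣ z
            p∤z d = [ (λ p∣81 → [ p∤9 , p∤9 ]′ (euclid (+ 9) (+ 9) p∣81)) , p∤D ]′
              (euclid (+ 81) D (≈0⇒∣ (≈-trans (≈-sym z²≈81D) (∣⇒≈0 (ℤ∣.∣m⇒∣m*n z d)))))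

        -- The discriminant 27² D of the cubic is not a square; two different roots would make it one.
        root-unique : ∀ x y → + p ∣ A * (x * x * x) - + 3 * x - 1ℤ → + p ∣ A * (y * y * y) - + 3 * y - 1ℤ → x ≈ y
        root-unique x y fx fy with + p ∣? (x - y)
        ... | yes d     = mod d
        ... | no  p∤x-y = [ (λ d → contradiction d p∤x-y) , (λ p∣q → contradiction (square p∣q) (81D≉square (t * w))) ]′
          (euclid (x - y) q (subst (+ p ∣_) (difference A x y) (ℤ∣.∣m∣n⇒∣m-n fx fy)))
          where
          open SetoidReasoning ≈-setoid
          -- Dividing the cubic by X - y leaves A X² + A y X + A y² - 3. Its value at x is `q`, its
          -- derivative there is `t`, and its value at y is 3 `w`. When `q` vanishes, t² is the
          -- discriminant of this quadratic, so that t² (3w)² is the discriminant 27² D of the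
          -- cubic; removing 9 leaves 81 D.
          q = A * (x * x + x * y + y * y) - + 3
          t = A * (+ 2 * x + y)
          w = A * (y * y) - 1ℤ
          difference : ∀ A x y → (A * (x * x * x) - + 3 * x - 1ℤ) - (A * (y * y * y) - + 3 * y - 1ℤ)
            ≡ (x - y) * (A * (x * x + x * y + y * y) - + 3)
          difference = solve-∀
          swap : ∀ t w → (t * w) * (t * w) ≡ t * t * (w * w)
          swap = solve-∀
          t² : ∀ A x y → (A * (+ 2 * x + y)) * (A * (+ 2 * x + y)) - + 3 * A * (+ 4 - A * (y * y))
            ≡ (A * (x * x + x * y + y * y) - + 3) * (+ 4 * A)
          t² = solve-∀
          w² : ∀ A y →
            + 3 * A * (+ 4 - A * (y * y)) * ((A * (y * y) - 1ℤ) * (A * (y * y) - 1ℤ)) - + 3 * (A * (+ 4 - A))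
              ≡ - ((A * (y * y * y) - + 3 * y - 1ℤ) * (+ 3 * A * A * (A * (y * y * y) - + 3 * y + 1ℤ)))
          w² = solve-∀
          81D : ∀ a → + 3 * ((+ 4 - + 27 * a) * (+ 4 - (+ 4 - + 27 * a))) ≡ + 81 * (a * (+ 4 - + 27 * a))
          81D = solve-∀
          square : + p ∣ q → (t * w) * (t * w) ≈ + 81 * D
          square p∣q = begin
            (t * w) * (t * w)
              ≡⟨ swap t w ⟩
            t * t * (w * w)
              ≈⟨ *-congʳ (w * w) t²≈ ⟩
            + 3 * A * (+ 4 - A * (y * y)) * (w * w)
              ≈⟨ mod (subst (+ p ∣_) (sym (w² A y))
                   (ℤ∣.∣m⇒∣-m (ℤ∣.∣m⇒∣m*n (+ 3 * A * A * (A * (y * y * y) - + 3 * y + 1ℤ)) fy))) ⟩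
            + 3 * (A * (+ 4 - A))
              ≡⟨ 81D a ⟩
            + 81 * D
              ∎
            where
            t²≈ : t * t ≈ + 3 * A * (+ 4 - A * (y * y))
            t²≈ = mod (subst (+ p ∣_) (sym (t² A x y)) (ℤ∣.∣m⇒∣m*n (+ 4 * A) p∣q))

      -- The image of u under Frobenius.

      module _ (p∤3 : ¬ + p ∣ + 3) (a : ℤ) (D^m≈-1 : (a * (+ 4 - + 27 * a)) ^ m ≈ - 1ℤ) where

        private
          y h D : ℤ
          y = - + 27 * a
          h = y + + 2
          D = a * (+ 4 - + 27 * a)

          -- h² - 4 is -3 · 9 · D, where 9 is a square and Dᵐ ≡ -1; the sign of (-3)ᵐ is therefore
          -- reversed.
          [h²-4]^m : (h * h - + 4) ^ m ≈ - ((- + 3) ^ m)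
          [h²-4]^m = begin
            (h * h - + 4) ^ m                        ≡⟨ cong (_^ m) (Δ a) ⟩
            (- + 3 * (+ 9 * D)) ^ m                  ≡⟨ ^-distrib-* (- + 3) (+ 9 * D) m ⟩
            (- + 3) ^ m * (+ 9 * D) ^ m              ≡⟨ cong ((- + 3) ^ m *_) (^-distrib-* (+ 9) D m) ⟩
            (- + 3) ^ m * ((+ 9) ^ m * D ^ m)        ≈⟨ *-congˡ ((- + 3) ^ m) (*-cong (x^2m≈1 (+ 3) p∤3) D^m≈-1) ⟩
            (- + 3) ^ m * - 1ℤ                       ≡⟨ neg ((- + 3) ^ m) ⟩
            - ((- + 3) ^ m)                          ∎
            where
            open SetoidReasoning ≈-setoid
            Δ : ∀ a → (- + 27 * a + + 2) * (- + 27 * a + + 2) - + 4 ≡ - + 3 * (+ 9 * (a * (+ 4 - + 27 * a)))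
            Δ = solve-∀
            neg : ∀ x → x * - 1ℤ ≡ - x
            neg = solve-∀

        open Frobenius h
        open SetoidReasoning K.setoid

        -- 3n + 3 is p + 2 or p + 1, so the power is u⁻¹ u² = u or u · u = u².
        u^[3n+3] : ∀ n → p ≡ 1 ℕ.+ 3 ℕ.* n ⊎ p ≡ 2 ℕ.+ 3 ℕ.* n →
          u ↑ (suc n ℕ.* 3) ≋ u ⊎ u ↑ (suc n ℕ.* 3) ≋ u ↑ 2
        u^[3n+3] n (inj₁ p≡1+3n) = inj₁ (begin
          u ↑ (suc n ℕ.* 3)        ≡⟨ cong (u ↑_) (trans (eq n) (cong (ℕ._+ 2) (sym p≡1+3n))) ⟩
          u ↑ (p ℕ.+ 2)            ≈⟨ ^-homo-* u p 2 ⟩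
          u ↑ p ⊗ u ↑ 2            ≈⟨ K.*-congʳ {u ↑ 2} (u^p≋u⁻¹ h (≈-trans [h²-4]^m (-‿cong ([-3]^m≈1 n p≡1+3n)))) ⟩
          u⁻¹ ⊗ (u ⊗ u ↑ 1)        ≈⟨ K.*-assoc u⁻¹ u (u ↑ 1) ⟨
          u⁻¹ ⊗ u ⊗ u ↑ 1          ≈⟨ K.*-congʳ {u ↑ 1} u⁻¹u ⟩
          ι 1ℤ ⊗ u ↑ 1             ≈⟨ K.*-identityˡ (u ↑ 1) ⟩
          u ↑ 1                    ≈⟨ K.*-identityʳ u ⟩
          u                        ∎)
          where
          eq : ∀ n → (1 ℕ.+ n) ℕ.* 3 ≡ 1 ℕ.+ 3 ℕ.* n ℕ.+ 2
          eq = ℕSolver.solve-∀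
        u^[3n+3] n (inj₂ p≡2+3n) = inj₂ (begin
          u ↑ (suc n ℕ.* 3)        ≡⟨ cong (u ↑_) (trans (eq n) (cong suc (sym p≡2+3n))) ⟩
          u ⊗ u ↑ p                ≈⟨ K.*-congˡ {u} (u^p≋u h (≈-trans [h²-4]^m (-‿cong ([-3]^m≈-1 n p≡2+3n)))) ⟩
          u ⊗ u                    ≈⟨ K.*-congˡ {u} (K.*-identityʳ u) ⟨
          u ↑ 2                    ∎)
          where
          eq : ∀ n → (1 ℕ.+ n) ℕ.* 3 ≡ 1 ℕ.+ (2 ℕ.+ 3 ℕ.* n)
          eq = ℕSolver.solve-∀

    -- The cubic congruence over the integers.

    cubicℤ : ℤ → ℤ → ℤ
    cubicℤ a x = (+ 27 * a - + 4) * x ^ 3 + + 3 * x + 1ℤ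

    binomSumℤ : ℤ → ℤ
    binomSumℤ a = ∑≤ (p ℕ./ 3) (λ k → + ((3 ℕ.* k) C k) * a ^ k)

    cubic-congruence : 3 < p → ∀ a → ¬ + p ∣ a * (+ 4 - + 27 * a) →
      (∀ y → y < p → ¬ a * (+ 4 - + 27 * a) ≈ + y * + y) →
      cubicℤ a (binomSumℤ a) ≈ 0ℤ × (∀ x → cubicℤ a x ≈ 0ℤ → x ≈ binomSumℤ a)
    cubic-congruence 3<p a p∤D D≉y² =
        root⇒cubic S S-root
      , λ x x-root → root-unique a p∤3 p∤D D^m≈-1 x S (cubic⇒root x x-root) S-root
      where
      m n : ℕ
      m = p ℕ./ 2
      n = p ℕ./ 3

      p≡1+2m : p ≡ suc (2 ℕ.* m)
      p≡1+2m = 2<p⇒p≡1+2[p/2] pr (ℕ.<-trans (ℕ.n<1+n 2) 3<p)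

      open OddPrime m p≡1+2m

      p≡±1 : p ≡ 1 ℕ.+ 3 ℕ.* n ⊎ p ≡ 2 ℕ.+ 3 ℕ.* n
      p≡±1 = 3<p⇒p≡±1 pr 3<p

      p∤3 : ¬ + p ∣ + 3
      p∤3 = n<p⇒p∤n (s≤s z≤n) 3<p

      A D S : ℤ
      A = + 4 - + 27 * a
      D = a * A
      S = binomSumℤ a

      D^m≈-1 : D ^ m ≈ - 1ℤ
      D^m≈-1 = euler D p∤D D≉y²

      -- The working form A x³ - 3x - 1 is the negative of the stated cubic; x * (x * (x * 1ℤ)) is
      -- `x ^ 3` unfolded.
      cubic-neg : ∀ a x → (+ 27 * a - + 4) * (x * (x * (x * 1ℤ))) + + 3 * x + 1ℤ ≡ - ((+ 4 - + 27 * a) * (x * x * x) - + 3 * x - 1ℤ)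
      cubic-neg = solve-∀

      root⇒cubic : ∀ x → + p ∣ A * (x * x * x) - + 3 * x - 1ℤ → cubicℤ a x ≈ 0ℤ
      root⇒cubic x d = ∣⇒≈0 (subst (+ p ∣_) (sym (cubic-neg a x)) (ℤ∣.∣m⇒∣-m d))

      cubic⇒root : ∀ x → cubicℤ a x ≈ 0ℤ → + p ∣ A * (x * x * x) - + 3 * x - 1ℤ
      cubic⇒root x e = subst (+ p ∣_) (ℤ.neg-involutive (A * (x * x * x) - + 3 * x - 1ℤ))
        (ℤ∣.∣m⇒∣-m (subst (+ p ∣_) (cubic-neg a x) (≈0⇒∣ e)))

      3n<p : 3 ℕ.* n < p
      3n<p = [ (λ eq → subst (3 ℕ.* n <_) (sym eq) (ℕ.n<1+n _)) , (λ eq → subst (3 ℕ.* n <_) (sym eq) (ℕ.m<n⇒m<1+n (ℕ.n<1+n _))) ]′ p≡±1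

      p∣[3n+1][3n+2] : + p ∣ + ((1 ℕ.+ 3 ℕ.* n) ℕ.* (2 ℕ.+ 3 ℕ.* n))
      p∣[3n+1][3n+2] = ∣ᵤ⇒∣ ([ (λ eq → subst (λ q → p ℕ∣.∣ q ℕ.* (2 ℕ.+ 3 ℕ.* n)) eq (ℕ∣.m∣m*n (2 ℕ.+ 3 ℕ.* n)))
                             , (λ eq → subst (λ q → p ℕ∣.∣ (1 ℕ.+ 3 ℕ.* n) ℕ.* q) eq (ℕ∣.n∣m*n (1 ℕ.+ 3 ℕ.* n))) ]′ p≡±1)

      S≈b : S ≈ b (- + 27 * a) n
      S≈b = ∑[3k]Ck*a^k≈b n 3n<p p∣[3n+1][3n+2] a

      S-root : + p ∣ A * (S * S * S) - + 3 * S - 1ℤ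
      S-root = subst (+ p ∣_) (regroup (A * (S * S * S)) S) (p∣x-y (begin
        A * (S * S * S)                  ≈⟨ *-congˡ A (*-cong (*-cong S≈b S≈b) S≈b) ⟩
        A * (c * c * c)                  ≡⟨ cong (_* (c * c * c)) (comm a) ⟩
        (- + 27 * a + + 4) * (c * c * c) ≈⟨ b-cubic (- + 27 * a) n (u^[3n+3] p∤3 a D^m≈-1 n p≡±1) ⟩
        + 3 * c + 1ℤ                     ≈⟨ +-congʳ 1ℤ (*-congˡ (+ 3) S≈b) ⟨
        + 3 * S + 1ℤ                     ∎))
        where
        open SetoidReasoning ≈-setoid
        c = b (- + 27 * a) n
        regroup : ∀ x y → x - (+ 3 * y + 1ℤ) ≡ x - + 3 * y - 1ℤ
        regroup = solve-∀
        comm : ∀ a → + 4 - + 27 * a ≡ - + 27 * a + + 4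
        comm = solve-∀

    -- p-integral rationals and their residues.

    infix 4 _↦_

    -- r ↦ z: the rational r is p-integral and its residue modulo p is that of z.
    record _↦_ (r : ℚ) (z : ℤ) : Set where
      constructor residue
      field
        p∤↧   : ¬ + p ∣ ↧ r
        ↥≈z*↧ : ↥ r ≈ z * ↧ r
    open _↦_

    private
      -- Sums and products of rationals are reduced to lowest terms, so their numerators and
      -- denominators are known only up to a common factor g. As p does not divide the unreduced
      -- denominator, it does not divide g, which then cancels.
      cancel-gcd : ∀ r g n d z → ↥ r * g ≡ n → ↧ r * g ≡ d → ¬ + p ∣ d → n ≈ z * d → r ↦ z
      cancel-gcd r g n d z ↥r*g≡n ↧r*g≡d p∤d n≈zd = residue
        (λ p∣↧ → p∤d (subst (+ p ∣_) ↧r*g≡d (ℤ∣.∣m⇒∣m*n g p∣↧)))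
        (*-cancelˡ g (λ p∣g → p∤d (subst (+ p ∣_) ↧r*g≡d (ℤ∣.∣n⇒∣m*n (↧ r) p∣g))) (begin
          g * ↥ r          ≡⟨ ℤ.*-comm g (↥ r) ⟩
          ↥ r * g          ≡⟨ ↥r*g≡n ⟩
          n                ≈⟨ n≈zd ⟩
          z * d            ≡⟨ cong (z *_) ↧r*g≡d ⟨
          z * (↧ r * g)    ≡⟨ eq z (↧ r) g ⟩
          g * (z * ↧ r)    ∎))
        where
        open SetoidReasoning ≈-setoid
        eq : ∀ x y z → x * (y * z) ≡ z * (x * y)
        eq = solve-∀

      p∤* : ∀ {x y} → ¬ + p ∣ x → ¬ + p ∣ y → ¬ + p ∣ x * y
      p∤* {x} {y} p∤x p∤y d = [ p∤x , p∤y ]′ (euclid x y d)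

    ↦-+ : ∀ {r s z w} → r ↦ z → s ↦ w → r ℚ.+ s ↦ z + w
    ↦-+ {r} {s} {z} {w} (residue p∤r r≈z) (residue p∤s s≈w) =
      cancel-gcd (r ℚ.+ s) (gcd (↥ r * ↧ s + ↥ s * ↧ r) (↧ r * ↧ s)) (↥ r * ↧ s + ↥ s * ↧ r) (↧ r * ↧ s) (z + w)
        (ℚ.↥-+ r s) (ℚ.↧-+ r s) (p∤* p∤r p∤s)
        (≈-trans (+-cong (*-congʳ (↧ s) r≈z) (*-congʳ (↧ r) s≈w)) (≡⇒≈ (eq z w (↧ r) (↧ s))))
      where
      eq : ∀ z w x y → z * x * y + w * y * x ≡ (z + w) * (x * y)
      eq = solve-∀

    ↦-* : ∀ {r s z w} → r ↦ z → s ↦ w → r ℚ.* s ↦ z * w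
    ↦-* {r} {s} {z} {w} (residue p∤r r≈z) (residue p∤s s≈w) =
      cancel-gcd (r ℚ.* s) (gcd (↥ r * ↥ s) (↧ r * ↧ s)) (↥ r * ↥ s) (↧ r * ↧ s) (z * w)
        (ℚ.↥-* r s) (ℚ.↧-* r s) (p∤* p∤r p∤s)
        (≈-trans (*-cong r≈z s≈w) (≡⇒≈ (eq z w (↧ r) (↧ s))))
      where
      eq : ∀ z w x y → z * x * (w * y) ≡ z * w * (x * y)
      eq = solve-∀

    ↦-neg : ∀ {r z} → r ↦ z → ℚ.- r ↦ - z
    ↦-neg {r} {z} (residue p∤r r≈z) = residue
      (λ d → p∤r (subst (+ p ∣_) (ℚ.↧-neg r) d))
      (≈-trans (≡⇒≈ (ℚ.↥-neg r)) (≈-trans (-‿cong r≈z)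
        (≡⇒≈ (trans (ℤ.neg-distribˡ-* z (↧ r)) (cong (- z *_) (sym (ℚ.↧-neg r)))))))

    ↦-minus : ∀ {r s z w} → r ↦ z → s ↦ w → r ℚ.- s ↦ z - w
    ↦-minus r↦z s↦w = ↦-+ r↦z (↦-neg s↦w)

    ↦-ℕ : ∀ n → ℕ→ℚ n ↦ + n
    ↦-ℕ n = cancel-gcd (ℕ→ℚ n) (gcd (+ n) (+ 1)) (+ n) (+ 1) (+ n) (ℚ.↥-/ (+ n) 1) (ℚ.↧-/ (+ n) 1) p∤1
      (≡⇒≈ (sym (ℤ.*-identityʳ (+ n))))

    ↦-0 : 0ℚ ↦ 0ℤ
    ↦-0 = residue p∤1 ≈-refl

    ↦-1 : 1ℚ ↦ 1ℤ
    ↦-1 = residue p∤1 ≈-refl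

    ↦-^ : ∀ {r z} → r ↦ z → ∀ n → r Defs.^ n ↦ z ^ n
    ↦-^ r↦z zero    = ↦-1
    ↦-^ r↦z (suc n) = ↦-* r↦z (↦-^ r↦z n)

    ↦-∑ : ∀ n {f g} → (∀ k → f k ↦ g k) → sumTo n f ↦ ∑≤ n g
    ↦-∑ zero    f↦g = f↦g zero
    ↦-∑ (suc n) f↦g = ↦-+ (↦-∑ n f↦g) (f↦g (suc n))

    ↦-≈⇒≡ : ∀ {r s z w} → r ↦ z → s ↦ w → z ≈ w → r ≡ s [modℚ p ]
    ↦-≈⇒≡ {r} {s} {z} {w} r↦z s↦w (mod z-w) = ∣⇒∣ᵤ (≈0⇒∣ (≈-trans (↥≈z*↧ r-s↦) (∣⇒≈0 (ℤ∣.∣m⇒∣m*n (↧ (r ℚ.- s)) z-w))))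
      where
      r-s↦ : r ℚ.- s ↦ z - w
      r-s↦ = ↦-minus r↦z s↦w

    ↦-≡⇒≈ : ∀ {r s z w} → r ↦ z → s ↦ w → r ≡ s [modℚ p ] → z ≈ w
    ↦-≡⇒≈ {r} {s} {z} {w} r↦z s↦w d =
      [ mod , (λ p∣↧ → contradiction p∣↧ (p∤↧ r-s↦)) ]′
        (euclid (z - w) (↧ (r ℚ.- s)) (≈0⇒∣ (≈-trans (≈-sym (↥≈z*↧ r-s↦)) (∣⇒≈0 (∣ᵤ⇒∣ d)))))
      where
      r-s↦ : r ℚ.- s ↦ z - w
      r-s↦ = ↦-minus r↦z s↦w

    inverse : ∀ x → ¬ + p ∣ x → ∃ λ x⁻¹ → x * x⁻¹ ≈ 1ℤ
    inverse x p∤x = x ^ (p ∸ 2) , *-cancelˡ x p∤x (begin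
      x * (x * x ^ (p ∸ 2))   ≡⟨ cong (x ^_) (ℕ.m+[n∸m]≡n 1<p) ⟩
      x ^ p                   ≈⟨ fermat x ⟩
      x                       ≡⟨ ℤ.*-identityʳ x ⟨
      x * 1ℤ                  ∎)
      where open SetoidReasoning ≈-setoid

    PIntegral⇒↦ : ∀ r → PIntegral p r → ∃ (r ↦_)
    PIntegral⇒↦ r p∤r = ↥ r * e , residue (λ d → p∤r (∣⇒∣ᵤ d)) (≈-sym (begin
      ↥ r * e * ↧ r      ≡⟨ eq (↥ r) e (↧ r) ⟩
      ↥ r * (↧ r * e)    ≈⟨ *-congˡ (↥ r) (proj₂ inv) ⟩
      ↥ r * 1ℤ           ≡⟨ ℤ.*-identityʳ (↥ r) ⟩
      ↥ r                ∎))
      where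
      open SetoidReasoning ≈-setoid
      inv = inverse (↧ r) (λ d → p∤r (∣⇒∣ᵤ d))
      e = proj₁ inv
      eq : ∀ x y z → x * y * z ≡ x * (z * y)
      eq = solve-∀

    -- The value -1 arises only when both Boolean tests fail, and a counterexample to either
    -- conclusion would make one of them succeed.
    legendre≡-1 : ∀ {r z} → r ↦ z → legendre p r ≡ -[1+ 0 ] →
      ¬ (+ p ∣ z) × (∀ y → y < p → ¬ z ≈ + y * + y)
    legendre≡-1 {r} {z} r↦z leg with congℚ? p r 0ℚ in r≢0 | any (λ y → congℚ? p r (ℕ→ℚ y ℚ.* ℕ→ℚ y)) (upTo p) in r≢y²
    legendre≡-1 {r} {z} r↦z () | true  | _
    legendre≡-1 {r} {z} r↦z () | false | true
    ... | false | false =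
        (λ p∣z → subst T r≢0 (holds 0ℚ (↦-≈⇒≡ r↦z ↦-0 (∣⇒≈0 p∣z))))
      , (λ y y<p z≈y² → subst T r≢y² (any⁺ (λ y → congℚ? p r (ℕ→ℚ y ℚ.* ℕ→ℚ y))
          (lose (∈-upTo⁺ y<p) (holds (ℕ→ℚ y ℚ.* ℕ→ℚ y) (↦-≈⇒≡ r↦z (↦-* (↦-ℕ y) (↦-ℕ y)) z≈y²)))))
      where
      holds : ∀ s → r ≡ s [modℚ p ] → T (congℚ? p r s)
      holds s d = subst T (sym (dec-true (p ℕ∣.∣? ℤ.∣ ↥ (r ℚ.- s) ∣) d)) _

    D↦ : ∀ {a a′} → a ↦ a′ → a ℚ.* (ℕ→ℚ 4 ℚ.- ℕ→ℚ 27 ℚ.* a) ↦ a′ * (+ 4 - + 27 * a′)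
    D↦ a↦ = ↦-* a↦ (↦-minus (↦-ℕ 4) (↦-* (↦-ℕ 27) a↦))

    binomSum↦ : ∀ {a a′} → a ↦ a′ → binomSum p a ↦ binomSumℤ a′
    binomSum↦ a↦ = ↦-∑ (p ℕ./ 3) (λ k → ↦-* (↦-ℕ ((3 ℕ.* k) C k)) (↦-^ a↦ k))

    cubic↦ : ∀ {a a′ x x′} → a ↦ a′ → x ↦ x′ → cubic a x ↦ cubicℤ a′ x′
    cubic↦ a↦ x↦ = ↦-+ (↦-+ (↦-* (↦-minus (↦-* (↦-ℕ 27) a↦) (↦-ℕ 4)) (↦-^ x↦ 3)) (↦-* (↦-ℕ 3) x↦)) ↦-1

open import Defs
open import Data.Rational using (_*_; _-_)

theorem3p10 : (p : ℕ) → Prime p → 3 < p →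
    (a : ℚ) → PIntegral p a →
    legendre p (a * (ℕ→ℚ 4 - ℕ→ℚ 27 * a)) ≡ -[1+ 0 ] →
    (cubic a (binomSum p a) ≡ Data.Rational.0ℚ [modℚ p ])
    × ((x : ℚ) → PIntegral p x → cubic a x ≡ Data.Rational.0ℚ [modℚ p ] →
    x ≡ binomSum p a [modℚ p ])
theorem3p10 p pr 3<p a a-int leg =
  -- p-integrality provides an integer residue of `a`, and likewise of any competing root x, so
  -- existence and uniqueness transfer from the integers.
  let open CubicCongruence.PrimeModulus p pr
      (a′ , a↦)         = PIntegral⇒↦ a a-int
      (p∤D , D≉y²)      = legendre≡-1 (D↦ a↦) leg
      (S-root , unique) = cubic-congruence 3<p a′ p∤D D≉y²
  in  ↦-≈⇒≡ (cubic↦ a↦ (binomSum↦ a↦)) ↦-0 S-root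
    , λ x x-int x-root →
        let (x′ , x↦) = PIntegral⇒↦ x x-int
        in  ↦-≈⇒≡ x↦ (binomSum↦ a↦) (unique x′ (↦-≡⇒≈ (cubic↦ a↦ x↦) ↦-0 x-root))
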